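{- Let $n\ge 3$ and $1\le r\le n-2$ be integers, and let $K_n$ be the complete graph on $n$ vertices. If $n$ is even, or $r$ is even, or $n$ is odd and either $r\ge \frac{n-1}{2}$ or $\gcd(r,n-1)=1$, then \[ ms_r(K_n)=\left\lfloor \frac{rn-1}{2}\right\rfloor. \]
   Context: All graphs are simple. For an integer $N$, $[N]=\{0,1,\dots,N-1\}$. An ordering of a graph $G=(V,E)$ is a bijection $\ell:E\to[|E|]$; edges are consecutive in $\ell$ if their labels are consecutive integers. A graph is $(\le r)$-regular if every vertex has degree at most $r$. For an ordering $\ell$ of $G$, $ms_r(\ell)$ is the largest integer $s$ such that every $s$ consecutive edges of $\ell$ form a $(\le r)$-regular subgraph of $G$; $ms_r(G)$ is the maximum of $ms_r(\ell)$ over all orderings $\ell$ of $G$. -}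

module Defs where

open import Data.Nat using (ℕ; _+_; _*_; _≤_; _<ᵇ_; _≤ᵇ_)
open import Data.Nat.Combinatorics using (_C_)
open import Data.Fin using (Fin; toℕ; _<_; _≟_)
open import Data.List using (List; length; filterᵇ; allFin)
open import Data.Bool using (Bool; _∧_; _∨_)
open import Data.Product using (Σ; ∃; _×_)
open import Function.Bundles using (_↔_; Inverse)
open import Relation.Nullary.Decidable using (⌊_⌋)

-- An edge of the complete graph K_n on vertex set Fin n:
-- an unordered pair {i, j}, represented uniquely with i < j.
record Edge (n : ℕ) : Set where
  constructor edge
  field
    lo hi : Fin n
    lo<hi : lo < hi

numEdges : ℕ → ℕ
numEdges n = n C 2

incident : ∀ {n} → Fin n → Edge n → Bool
incident v (edge i j _) = ⌊ v ≟ i ⌋ ∨ ⌊ v ≟ j ⌋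

Ordering : ℕ → Set
Ordering n = Edge n ↔ Fin (numEdges n)

windowDeg : ∀ {n} → Ordering n → ℕ → ℕ → Fin n → ℕ
windowDeg {n} ℓ k s v =
  length (filterᵇ (λ p → (k ≤ᵇ toℕ p) ∧ (toℕ p <ᵇ k + s) ∧ incident v (Inverse.from ℓ p))
                  (allFin (numEdges n)))

Good : ∀ {n} → ℕ → Ordering n → ℕ → Set
Good {n} r ℓ s = s ≤ numEdges n × (∀ k → k + s ≤ numEdges n → ∀ v → windowDeg ℓ k s v ≤ r)

-- ms_r(K_n) = m : m is the maximum over all orderings ℓ of ms_r(ℓ),
-- i.e. m is the largest s such that some ordering is Good for s.
MsK : ℕ → ℕ → ℕ → Set
MsK n r m = (Σ (Ordering n) λ ℓ → Good r ℓ m) × (∀ (ℓ : Ordering n) s → Good r ℓ s → s ≤ m)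

{-# OPTIONS --safe #-}
module Submission where

-- Upper bound: counting ends of edges gives 2s ≤ rn. If 2s = rn, every window is r-regular, so
-- the edge leaving and the edge entering when the window slides by one have the same ends.
--
-- Lower bound: put L = n - 1 vertices on a circle and one vertex ∞ outside. Edges are
-- grouped into rounds: a round consists of the chords with a common centre of reflection,
-- together with the edges joining ∞ to the fixed points, listed by distance from the centre.
-- An edge at v in round k with centre c then sits at position kn/2 + dist(v , c), up to a
-- constant. If the centres of rounds k and k + r differ by 1/2 (or by 1 when rn is even),
-- then two edges at v in rounds congruent modulo r are at least (rn - 1)/2 (respectively
-- (rn - 2)/2) apart, so colouring edges at v by round modulo r shows that a window contains
-- at most r of them. Such centres are obtained by sending each residue class of rounds modulo r
-- to an interval. For odd n the parity of the centre must alternate with the round; for odd r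
-- this is achieved by choosing the directions in which the intervals are traversed.

open import Defs
open import Data.Bool using (Bool; true; false; if_then_else_; not; T; _∧_; _∨_)
open import Data.Bool.Properties using (T-∧; T-∨)
open import Data.Fin as F using (Fin; toℕ)
import Data.Fin.Properties as F
open import Data.List using (List; _∷_; length; lookup; allFin; filter; filterᵇ; tabulate)
open import Data.List.Membership.Propositional using (_∈_)
open import Data.List.Membership.Propositional.Properties using (∈-lookup; ∈-filter⁻)
import Data.List.Relation.Unary.All as All
open import Data.List.Relation.Unary.AllPairs using (_∷_)
open import Data.List.Relation.Unary.Unique.Propositional using (Unique)
open import Data.List.Relation.Unary.Unique.Propositional.Properties using (filter⁺; allFin⁺)
open import Data.Nat hiding (Ordering)
open import Data.Nat.Combinatorics using (nC1≡n; nCk+nC[k+1]≡[n+1]C[k+1])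
open import Data.Nat.Divisibility using (_∣_; n∣m*n)
open import Data.Nat.DivMod using (_mod_; m≡m%n+[m/n]*n; m/n*n≤m; m*n/n≡m; m%n≤n; m%n<n; m≤n⇒m%n≡m; [m+kn]%n≡m%n; /-monoˡ-≤; +-distrib-/-∣ʳ)
open import Data.Nat.GCD using (gcd)
open import Data.Nat.Properties
open import Data.Nat.Tactic.RingSolver using (solve-∀)
open import Data.Parity using (Parity; 0ℙ; 1ℙ; _⁻¹) renaming (_+_ to _⊕_; _*_ to _⊛_)
import Data.Parity.Properties as ℙ
open import Data.Product using (Σ; ∃; _×_; _,_; proj₁; proj₂)
open import Data.Sum using (_⊎_; inj₁; inj₂; [_,_]′)
open import Function using (_∘_; const; id)
open import Function.Bundles using (Equivalence; Inverse; mk↔ₛ′)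
open import Function.Definitions using (Injective)
open import Relation.Binary.Definitions using (tri<; tri≈; tri>)
open import Relation.Binary.PropositionalEquality
open import Relation.Nullary using (¬_; Dec; yes; no; contradiction)
open import Relation.Nullary.Decidable using (⌊_⌋; T?; fromWitness; toWitness)
open import Algebra.Properties.CommutativeMonoid.Sum +-0-commutativeMonoid using (sum; sum-cong-≗; ∑-distrib-+; ∑-comm; sum-replicate-zero)

-- Counting edges

injective⇒surjective : ∀ {n} {f : Fin n → Fin n} → Injective _≡_ _≡_ f → ∀ y → ∃ λ x → f x ≡ y
injective⇒surjective {suc n} {f} inj y with F.any? (λ x → f x F.≟ y)
... | yes hit = hit
... | no miss = contradiction (F.injective⇒≤ λ {i} {j} eq → inj (F.punchOut-injective (y≢f i) (y≢f j) eq)) 1+n≰n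
  where
  y≢f : ∀ i → y ≢ f i
  y≢f i eq = miss (i , sym eq)

injective⇒surjective-< : ∀ {L} (f : ℕ → ℕ) → (∀ {k} → k < L → f k < L) →
  (∀ {k k′} → k < L → k′ < L → f k ≡ f k′ → k ≡ k′) → ∀ {a} → a < L → ∃ λ k → k < L × f k ≡ a
injective⇒surjective-< {L} f bound inj {a} a<L with injective⇒surjective fF-inj (F.fromℕ< a<L)
  where
  fF : Fin L → Fin L
  fF i = F.fromℕ< (bound (F.toℕ<n i))
  fF-inj : Injective _≡_ _≡_ fF
  fF-inj {i} {j} eq = F.toℕ-injective (inj (F.toℕ<n i) (F.toℕ<n j) (F.fromℕ<-injective _ _ _ _ eq))
... | i , eq = toℕ i , F.toℕ<n i , F.fromℕ<-injective _ _ _ _ eq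

edge-≡ : ∀ {n} {e e′ : Edge n} → Edge.lo e ≡ Edge.lo e′ → Edge.hi e ≡ Edge.hi e′ → e ≡ e′
edge-≡ {e = edge i j p} {edge .i .j p′} refl refl = cong (edge i j) (≤-irrelevant p p′)

numEdges-suc : ∀ n → numEdges (suc n) ≡ n + numEdges n
numEdges-suc n = trans (sym (nCk+nC[k+1]≡[n+1]C[k+1] n 1)) (cong (_+ numEdges n) (nC1≡n n))

2*numEdges : ∀ L → 2 * numEdges (suc L) ≡ suc L * L
2*numEdges zero    = refl
2*numEdges (suc L) = begin
  2 * numEdges (suc (suc L))          ≡⟨ cong (2 *_) (numEdges-suc (suc L)) ⟩
  2 * (suc L + numEdges (suc L))      ≡⟨ *-distribˡ-+ 2 (suc L) _ ⟩
  2 * suc L + 2 * numEdges (suc L)    ≡⟨ cong (2 * suc L +_) (2*numEdges L) ⟩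
  2 * suc L + suc L * L               ≡⟨ lemma L ⟩
  suc (suc L) * suc L                 ∎
  where
  open ≡-Reasoning
  lemma : ∀ L → 2 * suc L + suc L * L ≡ suc (suc L) * suc L
  lemma = solve-∀

raise : ∀ {n} → Edge n → Edge (suc n)
raise (edge i j i<j) = edge (F.suc i) (F.suc j) (s≤s i<j)

-- An injection is enough: followed by an injective map from edges to `Fin (numEdges n)` it becomes
-- an injective self-map of a finite set, which is onto. `place-surjective` obtains its preimages
-- this way.
enumerate : ∀ n → ∃ λ (f : Fin (numEdges n) → Edge n) → Injective _≡_ _≡_ f
enumerate zero = (λ ()) , λ { {()} }
enumerate (suc n) = subst (λ N → ∃ λ (f : Fin N → Edge (suc n)) → Injective _≡_ _≡_ f)
                          (sym (numEdges-suc n)) (f ∘ F.splitAt n , inj)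
  where
  rec = proj₁ (enumerate n)
  f : Fin n ⊎ Fin (numEdges n) → Edge (suc n)
  f (inj₁ i) = edge F.zero (F.suc i) (s≤s z≤n)
  f (inj₂ p) = raise (rec p)
  raise-injective : ∀ {e e′ : Edge n} → raise e ≡ raise e′ → e ≡ e′
  raise-injective eq = edge-≡ (F.suc-injective (cong Edge.lo eq)) (F.suc-injective (cong Edge.hi eq))
  f-inj : Injective _≡_ _≡_ f
  f-inj {inj₁ i} {inj₁ j} eq = cong inj₁ (F.suc-injective (cong Edge.hi eq))
  f-inj {inj₁ i} {inj₂ p} eq = contradiction (cong Edge.lo eq) λ ()
  f-inj {inj₂ p} {inj₁ i} eq = contradiction (cong Edge.lo eq) λ ()
  f-inj {inj₂ p} {inj₂ p′} eq = cong inj₂ (proj₂ (enumerate n) (raise-injective eq))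
  inj : Injective _≡_ _≡_ (f ∘ F.splitAt n)
  inj {p} {p′} eq = trans (sym (F.join-splitAt n _ p))
                   (trans (cong (F.join n _) (f-inj {F.splitAt n p} {F.splitAt n p′} eq)) (F.join-splitAt n _ p′))

-- Sequences of centres

[m+kn]/n≡m/n+k : ∀ m k n .{{_ : NonZero n}} → (m + k * n) / n ≡ m / n + k
[m+kn]/n≡m/n+k m k n = trans (+-distrib-/-∣ʳ m (n∣m*n k)) (cong (m / n +_) (m*n/n≡m k n))

-- Truncation at 0 only brings the two values closer. This gives `σ-spread` for all `k`, including
-- those beyond `L`.
∸-spread : ∀ a i t → ∣ a ∸ i - a ∸ (i + t) ∣ ≤ t
∸-spread a i t = begin
  ∣ a ∸ i - a ∸ (i + t) ∣   ≡⟨ cong (∣ a ∸ i -_∣) (∸-+-assoc a i t) ⟨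
  ∣ a ∸ i - a ∸ i ∸ t ∣     ≡⟨ m≤n⇒∣n-m∣≡n∸m (m∸n≤m (a ∸ i) t) ⟩
  a ∸ i ∸ (a ∸ i ∸ t)       ≤⟨ m≤n+o⇒m∸n≤o (a ∸ i) (a ∸ i ∸ t) (≤-trans (m≤n+m∸n (a ∸ i) t) (≤-reflexive (+-comm t _))) ⟩
  t                         ∎
  where open ≤-Reasoning

parity-suc : ∀ c → parity (suc c) ≡ parity c ⁻¹
parity-suc = ℙ.+-homo-+ 1

parity-m+m : ∀ m → parity (m + m) ≡ 0ℙ
parity-m+m m = trans (ℙ.+-homo-+ m m) (ℙ.p+p≡0ℙ (parity m))

twice : ∀ a b → parity a ≡ parity (a + (b + b))
twice a b = sym (trans (ℙ.+-homo-+ a (b + b)) (trans (cong (parity a ⊕_) (parity-m+m b)) (ℙ.+-identityʳ _)))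

-- The numbers k < L are split into columns by k % r; σ maps the columns, in order, to
-- consecutive intervals, each traversed upwards or (if flipped) downwards.
module Columns (L r : ℕ) .{{_ : NonZero r}} where

  q t : ℕ
  q = L / r
  t = L % r

  -- The first `t` columns have `suc q` entries and the others `q`, so `c ⊓ t` counts the long
  -- columns before column `c`.
  start : ℕ → ℕ
  start c = c * q + c ⊓ t

  start-mono : ∀ {c c′} → c ≤ c′ → start c ≤ start c′
  start-mono c≤c′ = +-mono-≤ (*-monoˡ-≤ q c≤c′) (⊓-monoˡ-≤ t c≤c′)

  start-r : start r ≡ L
  start-r = begin
    r * q + r ⊓ t   ≡⟨ cong₂ _+_ (*-comm r q) (m≥n⇒m⊓n≡n (m%n≤n L r)) ⟩
    q * r + t       ≡⟨ +-comm (q * r) t ⟩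
    t + q * r       ≡⟨ m≡m%n+[m/n]*n L r ⟨
    L               ∎
    where open ≡-Reasoning

  start-suc-< : ∀ {c} → c < t → start (suc c) ≡ start c + suc q
  start-suc-< {c} c<t = begin
    q + c * q + suc c ⊓ t   ≡⟨ cong (q + c * q +_) (m≤n⇒m⊓n≡m c<t) ⟩
    q + c * q + suc c       ≡⟨ lemma q (c * q) c ⟩
    c * q + c + suc q       ≡⟨ cong (λ x → c * q + x + suc q) (m≤n⇒m⊓n≡m (<⇒≤ c<t)) ⟨
    start c + suc q         ∎
    where
    open ≡-Reasoning
    lemma : ∀ q a c → q + a + suc c ≡ a + c + suc q
    lemma = solve-∀

  start-suc-≥ : ∀ {c} → t ≤ c → start (suc c) ≡ start c + q
  start-suc-≥ {c} t≤c = begin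
    q + c * q + suc c ⊓ t   ≡⟨ cong (q + c * q +_) (m≥n⇒m⊓n≡n (m≤n⇒m≤1+n t≤c)) ⟩
    q + c * q + t           ≡⟨ lemma q (c * q) t ⟩
    c * q + t + q           ≡⟨ cong (λ x → c * q + x + q) (m≥n⇒m⊓n≡n t≤c) ⟨
    start c + q             ∎
    where
    open ≡-Reasoning
    lemma : ∀ q a c → q + a + c ≡ a + c + q
    lemma = solve-∀

  -- Always `k / r ≤ q`, which is enough in a long column. In a short one `t ≤ k % r`, and comparing
  -- `k < L` with `L = t + q * r` forces `k / r < q`.
  inColumn : ∀ {k} → k < L → start (k % r) + k / r < start (suc (k % r))
  inColumn {k} k<L with <-≤-connex (k % r) t
  ... | inj₁ c<t = subst (start (k % r) + k / r <_) (sym (start-suc-< c<t))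
                     (+-monoʳ-< (start (k % r)) (s≤s (/-monoˡ-≤ r (<⇒≤ k<L))))
  ... | inj₂ t≤c = subst (start (k % r) + k / r <_) (sym (start-suc-≥ t≤c))
                     (+-monoʳ-< (start (k % r)) (*-cancelʳ-< r (k / r) q (+-cancelˡ-< t _ _ (begin-strict
      t + k / r * r       ≤⟨ +-monoˡ-≤ _ t≤c ⟩
      k % r + k / r * r   ≡⟨ m≡m%n+[m/n]*n k r ⟨
      k                   <⟨ k<L ⟩
      L                   ≡⟨ m≡m%n+[m/n]*n L r ⟩
      t + q * r           ∎))))
    where open ≤-Reasoning hiding (start)

  module Arranged (flip : ℕ → Bool) where

    slot : ℕ → ℕ → ℕ
    slot c i = if flip c then start (suc c) ∸ suc i else start c + i

    σ : ℕ → ℕ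
    σ k = slot (k % r) (k / r)

    slot-lower : ∀ c i → start c + i < start (suc c) → start c ≤ slot c i
    slot-lower c i h with flip c
    ... | false = m≤m+n (start c) i
    ... | true  = m+n≤o⇒m≤o∸n (start c) (≤-trans (≤-reflexive (+-suc (start c) i)) h)

    slot-upper : ∀ c i → start c + i < start (suc c) → slot c i < start (suc c)
    slot-upper c i h with flip c
    ... | false = h
    ... | true  = ∸-monoʳ-< {o = 0} (s≤s z≤n) (≤-trans (s≤s (m≤n+m i (start c))) h)

    slot-injective : ∀ c {i j} → start c + i < start (suc c) → start c + j < start (suc c) →
                     slot c i ≡ slot c j → i ≡ j
    slot-injective c {i} {j} h h′ eq with flip c
    ... | false = +-cancelˡ-≡ (start c) i j eq
    ... | true  = suc-injective (∸-cancelˡ-≡ (≤-trans (s≤s (m≤n+m i (start c))) h)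
                                              (≤-trans (s≤s (m≤n+m j (start c))) h′) eq)

    σ-bound : ∀ {k} → k < L → σ k < L
    σ-bound {k} k<L = <-≤-trans (slot-upper (k % r) (k / r) (inColumn k<L))
      (≤-trans (start-mono (m%n<n k r)) (≤-reflexive start-r))

    sameColumn : ∀ {c c′ a} → start c ≤ a → a < start (suc c) → start c′ ≤ a → a < start (suc c′) → c ≡ c′
    sameColumn {c} {c′} l u l′ u′ with <-cmp c c′
    ... | tri≈ _ eq _ = eq
    ... | tri< c<c′ _ _ = contradiction (<-≤-trans u (≤-trans (start-mono c<c′) l′)) (<-irrefl refl)
    ... | tri> _ _ c′<c = contradiction (<-≤-trans u′ (≤-trans (start-mono c′<c) l)) (<-irrefl refl)

    σ-injective : ∀ {k k′} → k < L → k′ < L → σ k ≡ σ k′ → k ≡ k′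
    σ-injective {k} {k′} k<L k′<L eq = begin
      k                       ≡⟨ m≡m%n+[m/n]*n k r ⟩
      k % r + k / r * r       ≡⟨ cong₂ (λ c i → c + i * r) c≡c′ i≡i′ ⟩
      k′ % r + k′ / r * r     ≡⟨ m≡m%n+[m/n]*n k′ r ⟨
      k′                      ∎
      where
      open ≡-Reasoning
      c≡c′ : k % r ≡ k′ % r
      c≡c′ = sameColumn (slot-lower (k % r) (k / r) (inColumn k<L)) (slot-upper (k % r) (k / r) (inColumn k<L))
               (subst (start (k′ % r) ≤_) (sym eq) (slot-lower (k′ % r) (k′ / r) (inColumn k′<L)))
               (subst (_< start (suc (k′ % r))) (sym eq) (slot-upper (k′ % r) (k′ / r) (inColumn k′<L)))
      i≡i′ : k / r ≡ k′ / r
      i≡i′ = slot-injective (k % r) (inColumn k<L)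
               (subst (λ c → start c + k′ / r < start (suc c)) (sym c≡c′) (inColumn k′<L))
               (trans eq (cong (λ c → slot c (k′ / r)) (sym c≡c′)))

    slot-spread : ∀ c i u → ∣ slot c i - slot c (i + u) ∣ ≤ u
    slot-spread c i u with flip c
    ... | false = ≤-reflexive (trans (∣m+n-m+o∣≡∣n-o∣ (start c) i (i + u)) (∣m-m+n∣≡n i u))
    ... | true  = ∸-spread (start (suc c)) (suc i) u

    σ-spread : ∀ k u → ∣ σ k - σ (k + u * r) ∣ ≤ u
    σ-spread k u = subst₂ (λ c i → ∣ σ k - slot c i ∣ ≤ u)
      (sym ([m+kn]%n≡m%n k u r)) (sym ([m+kn]/n≡m/n+k k u r)) (slot-spread (k % r) (k / r) u)

    σ-surjective : ∀ {a} → a < L → ∃ λ k → k < L × σ k ≡ a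
    σ-surjective = injective⇒surjective-< σ σ-bound σ-injective

  -- Along a column k changes by the odd number r while σ k changes by 1, so the parity of
  -- σ k + k is constant on a column; choosing its direction makes that parity q throughout.
  module Alternating (L-even : parity L ≡ 0ℙ) (r-odd : parity r ≡ 1ℙ) where

    -- Reduce `L = t + q * r` modulo 2, with `L` even and `r` odd.
    parity-t : parity t ≡ parity q
    parity-t = lemma (begin
      0ℙ                                ≡⟨ L-even ⟨
      parity L                          ≡⟨ cong parity (m≡m%n+[m/n]*n L r) ⟩
      parity (t + q * r)                ≡⟨ ℙ.+-homo-+ t (q * r) ⟩
      parity t ⊕ parity (q * r)         ≡⟨ cong (parity t ⊕_) (ℙ.*-homo-* q r) ⟩
      parity t ⊕ (parity q ⊛ parity r)  ≡⟨ cong (λ p → parity t ⊕ (parity q ⊛ p)) r-odd ⟩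
      parity t ⊕ (parity q ⊛ 1ℙ)        ∎)
      where
      open ≡-Reasoning
      lemma : ∀ {a b} → 0ℙ ≡ a ⊕ (b ⊛ 1ℙ) → a ≡ b
      lemma {0ℙ} {0ℙ} _ = refl
      lemma {1ℙ} {1ℙ} _ = refl

    parity-start : ∀ c → parity (start c + c) ≡ (parity c ⊛ parity q) ⊕ parity (c ⊓ t) ⊕ parity c
    parity-start c = trans (ℙ.+-homo-+ (start c) c) (cong (_⊕ parity c)
      (trans (ℙ.+-homo-+ (c * q) (c ⊓ t)) (cong (_⊕ parity (c ⊓ t)) (ℙ.*-homo-* c q))))

    parity-start-≤ : ∀ {c} → c ≤ t → parity (start c + c) ≡ parity c ⊛ parity q
    parity-start-≤ {c} c≤t = trans (parity-start c)
      (trans (cong (λ x → (parity c ⊛ parity q) ⊕ parity x ⊕ parity c) (m≤n⇒m⊓n≡m c≤t)) (lemma (parity c) (parity q)))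
      where
      lemma : ∀ a b → (a ⊛ b) ⊕ a ⊕ a ≡ a ⊛ b
      lemma 0ℙ _  = refl
      lemma 1ℙ 0ℙ = refl
      lemma 1ℙ 1ℙ = refl

    parity-start-≥ : ∀ {c} → t ≤ c → parity (start c + c) ≡ (parity c ⊛ parity q) ⊕ parity q ⊕ parity c
    parity-start-≥ {c} t≤c = trans (parity-start c)
      (cong (λ x → (parity c ⊛ parity q) ⊕ x ⊕ parity c) (trans (cong parity (m≥n⇒m⊓n≡n t≤c)) parity-t))

    parity-i+ir : ∀ i → parity (i + i * r) ≡ 0ℙ
    parity-i+ir i = trans (ℙ.+-homo-+ i (i * r)) (trans (cong (parity i ⊕_)
      (trans (ℙ.*-homo-* i r) (cong (parity i ⊛_) r-odd))) (lemma (parity i)))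
      where
      lemma : ∀ a → a ⊕ (a ⊛ 1ℙ) ≡ 0ℙ
      lemma 0ℙ = refl
      lemma 1ℙ = refl

    -- Upwards, column `c` begins at `start c` and its invariant is the parity of `start c + c`;
    -- downwards it begins at `start (suc c) - 1`, and the invariant is that of
    -- `start (suc c) + suc c`. Modulo 2, `start c + c` differs from `q` by `(c + 1) q` for `c ≤ t`
    -- and by `c (q + 1)` for `c ≥ t`. In either range the factor containing `c` alternates, so the
    -- difference vanishes at `c` or at `suc c`.
    aligned : ∀ c → parity (start c + c) ≢ parity q → parity (start (suc c) + suc c) ≡ parity q
    aligned c ≢q with <-≤-connex c t
    ... | inj₁ c<t = trans (parity-start-≤ c<t) (trans (cong (_⊛ parity q) (parity-suc c))
                       (lemma (parity c) (parity q) (≢q ∘ trans (parity-start-≤ (<⇒≤ c<t)))))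
      where
      lemma : ∀ a b → a ⊛ b ≢ b → (a ⁻¹) ⊛ b ≡ b
      lemma 0ℙ b _ = refl
      lemma 1ℙ b ≢ = contradiction refl ≢
    ... | inj₂ t≤c = trans (parity-start-≥ (m≤n⇒m≤1+n t≤c)) (trans (cong (λ p → (p ⊛ parity q) ⊕ parity q ⊕ p) (parity-suc c))
                       (lemma (parity c) (parity q) (≢q ∘ trans (parity-start-≥ t≤c))))
      where
      lemma : ∀ a b → (a ⊛ b) ⊕ b ⊕ a ≢ b → ((a ⁻¹) ⊛ b) ⊕ b ⊕ (a ⁻¹) ≡ b
      lemma 0ℙ 0ℙ ≢ = contradiction refl ≢
      lemma 0ℙ 1ℙ ≢ = refl
      lemma 1ℙ 0ℙ ≢ = refl
      lemma 1ℙ 1ℙ ≢ = refl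

    flips : ℕ → Bool
    flips c = not ⌊ parity (start c + c) ℙ.≟ parity q ⌋

    open Arranged flips

    slot-parity : ∀ c i → start c + i < start (suc c) → parity (slot c i + (c + i * r)) ≡ parity q
    slot-parity c i h with parity (start c + c) ℙ.≟ parity q
    ... | yes ≡q = begin
      parity (start c + i + (c + i * r))          ≡⟨ cong parity (lemma (start c) i c (i * r)) ⟩
      parity (start c + c + (i + i * r))          ≡⟨ ℙ.+-homo-+ (start c + c) _ ⟩
      parity (start c + c) ⊕ parity (i + i * r)   ≡⟨ cong₂ _⊕_ ≡q (parity-i+ir i) ⟩
      parity q ⊕ 0ℙ                               ≡⟨ ℙ.+-identityʳ _ ⟩
      parity q                                    ∎
      where
      open ≡-Reasoning
      lemma : ∀ a i c x → a + i + (c + x) ≡ a + c + (i + x)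
      lemma = solve-∀
    ... | no ≢q = begin
      -- One added copy of `suc i` undoes the subtraction in `a`; the other turns `c + i * r` into
      -- `suc c + (i + i * r)`.
      parity (a + (c + i * r))                        ≡⟨ twice (a + (c + i * r)) (suc i) ⟩
      parity (a + (c + i * r) + (suc i + suc i))      ≡⟨ cong parity (lemma a c (i * r) i) ⟩
      parity (a + suc i + suc c + (i + i * r))        ≡⟨ cong (λ x → parity (x + suc c + (i + i * r))) (m∸n+n≡m i<end) ⟩
      parity (start (suc c) + suc c + (i + i * r))    ≡⟨ ℙ.+-homo-+ (start (suc c) + suc c) _ ⟩
      parity (start (suc c) + suc c) ⊕ parity (i + i * r) ≡⟨ cong₂ _⊕_ (aligned c ≢q) (parity-i+ir i) ⟩
      parity q ⊕ 0ℙ                                   ≡⟨ ℙ.+-identityʳ _ ⟩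
      parity q                                        ∎
      where
      open ≡-Reasoning
      a = start (suc c) ∸ suc i
      i<end : suc i ≤ start (suc c)
      i<end = ≤-trans (s≤s (m≤n+m i (start c))) h
      lemma : ∀ a c x i → a + (c + x) + (suc i + suc i) ≡ a + suc i + suc c + (i + x)
      lemma = solve-∀

    σ-parity : ∀ {k} → k < L → parity (σ k + k) ≡ parity q
    σ-parity {k} k<L = trans (cong (λ x → parity (σ k + x)) (m≡m%n+[m/n]*n k r))
                             (slot-parity (k % r) (k / r) (inColumn k<L))

-- Degrees in windows

lookup-injective : ∀ {a} {A : Set a} {xs : List A} → Unique xs → Injective _≡_ _≡_ (lookup xs)
lookup-injective {xs = _ ∷ xs} (x≢ ∷ u) {F.zero}  {F.zero}  eq = refl
lookup-injective {xs = _ ∷ xs} (x≢ ∷ u) {F.zero}  {F.suc j} eq = contradiction eq (All.lookup x≢ (∈-lookup j))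
lookup-injective {xs = _ ∷ xs} (x≢ ∷ u) {F.suc i} {F.zero}  eq = contradiction (sym eq) (All.lookup x≢ (∈-lookup i))
lookup-injective {xs = _ ∷ xs} (x≢ ∷ u) {F.suc i} {F.suc j} eq = cong F.suc (lookup-injective u eq)

length-≤-colours : ∀ {a} {A : Set a} {xs : List A} {r} → Unique xs → (colour : A → Fin r) →
  (∀ {x y} → x ∈ xs → y ∈ xs → colour x ≡ colour y → x ≡ y) → length xs ≤ r
length-≤-colours {xs = xs} u colour inj = F.injective⇒≤ {f = colour ∘ lookup xs}
  λ {i} {j} eq → lookup-injective u (inj (∈-lookup i) (∈-lookup j) eq)

position : ∀ {n} → Ordering n → Edge n → ℕ
position ℓ e = toℕ (Inverse.to ℓ e)

-- Positions inside one window differ by less than `s`, so `colour` is injective on the edges at `v`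
-- in it, and there are only `r` colours.
windowDeg-≤ : ∀ {n r} (ℓ : Ordering n) s v (colour : Edge n → Fin r) →
  (∀ {e e′} → T (incident v e) → T (incident v e′) → colour e ≡ colour e′ →
     e ≡ e′ ⊎ position ℓ e + s ≤ position ℓ e′ ⊎ position ℓ e′ + s ≤ position ℓ e) →
  ∀ k → windowDeg ℓ k s v ≤ r
windowDeg-≤ {n} ℓ s v colour separated k =
  length-≤-colours (filter⁺ (T? ∘ inside) (allFin⁺ (numEdges n))) (colour ∘ from) λ p∈ p′∈ → distinct (unpack p∈) (unpack p′∈)
  where
  open Inverse ℓ using (from; strictlyInverseˡ)
  inside : Fin (numEdges n) → Bool
  inside p = (k ≤ᵇ toℕ p) ∧ (toℕ p <ᵇ k + s) ∧ incident v (from p)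
  Inside : Fin (numEdges n) → Set
  Inside p = k ≤ toℕ p × toℕ p < k + s × T (incident v (from p))
  unpack : ∀ {p} → p ∈ filter (T? ∘ inside) (allFin (numEdges n)) → Inside p
  unpack {p} p∈ with Equivalence.to T-∧ (proj₂ (∈-filter⁻ (T? ∘ inside) {xs = allFin (numEdges n)} p∈))
  ... | k≤p , rest with Equivalence.to T-∧ rest
  ... | p<k+s , inc = ≤ᵇ⇒≤ k (toℕ p) k≤p , <ᵇ⇒< (toℕ p) (k + s) p<k+s , inc
  tooFar : ∀ {p p′} → Inside p → Inside p′ → ¬ (position ℓ (from p) + s ≤ position ℓ (from p′))
  tooFar {p} {p′} (k≤p , _) (_ , p′<k+s , _) h = <⇒≱ p′<k+s (≤-trans (+-monoˡ-≤ s k≤p)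
    (subst₂ (λ a b → toℕ a + s ≤ toℕ b) (strictlyInverseˡ p) (strictlyInverseˡ p′) h))
  distinct : ∀ {p p′} → Inside p → Inside p′ → colour (from p) ≡ colour (from p′) → p ≡ p′
  distinct {p} {p′} in-p@(_ , _ , inc) in-p′@(_ , _ , inc′) eq with separated inc inc′ eq
  ... | inj₁ e≡e′ = trans (sym (strictlyInverseˡ p)) (trans (cong (Inverse.to ℓ) e≡e′) (strictlyInverseˡ p′))
  ... | inj₂ (inj₁ h) = contradiction h (tooFar in-p in-p′)
  ... | inj₂ (inj₂ h) = contradiction h (tooFar in-p′ in-p)

-- Centres of edges

-- The circle has circumference L and distances are doubled to stay integral. For the edge
-- {x , y} with y = x + d, C is twice a centre of reflection exchanging x and y, and D is
-- twice the distance from that centre to x and y. The two antipodal centres (x + y) / 2 and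
-- (x + y ± L) / 2 are both allowed.
data Centre (L x d C D : ℕ) : Set where
  near  : C ≡ x + (x + d) → D ≡ d → Centre L x d C D
  below : D + d ≡ L → x + x ≡ C + D → Centre L x d C D
  above : D + d ≡ L → C ≡ (x + d) + (x + d) + D → Centre L x d C D

double-injective : ∀ {a b} → a + a ≡ b + b → a ≡ b
double-injective {a} {b} eq = *-cancelˡ-≡ a b 2 (trans (lemma a) (trans eq (sym (lemma b))))
  where
  lemma : ∀ a → 2 * a ≡ a + a
  lemma = solve-∀

-- If both constructors agree, the ends are read off from `C` and `D`. If they differ, the equations
-- make one end of one edge equal to an end of the other plus `L`, although all ends are below `L`.
Centre-injective : ∀ {L x d x′ d′ C D} → x + d < L → x′ + d′ < L →
  Centre L x d C D → Centre L x′ d′ C D → x ≡ x′ × d ≡ d′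
Centre-injective {L} {x} {d} {x′} {d′} {C} {D} y<L y′<L = go
  where
  near-below : ∀ {x d x′ d′} → x′ + d′ < L → C ≡ x + (x + d) → D ≡ d → D + d′ ≡ L → x′ + x′ ≡ C + D → ∀ {P : Set} → P
  near-below {x} {d} {x′} {d′} y′<L refl refl refl eq = contradiction
    (≤-trans (m≤n+m (d + d′) x) (≤-reflexive (trans (sym (+-assoc x d d′)) (cong (_+ d′) (sym (double-injective (trans eq (lemma x d)))))))) (<⇒≱ y′<L)
    where
    lemma : ∀ x d → x + (x + d) + d ≡ (x + d) + (x + d)
    lemma = solve-∀
  near-above : ∀ {x d x′ d′} → x + d < L → C ≡ x + (x + d) → D ≡ d → D + d′ ≡ L → C ≡ (x′ + d′) + (x′ + d′) + D → ∀ {P : Set} → P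
  near-above {x} {d} {x′} {d′} y<L refl refl refl eq = contradiction
    (≤-trans (m≤n+m (d + d′) x′) (≤-reflexive (trans (lemma x′ d d′) (cong (_+ d) (sym x≡))))) (<⇒≱ y<L)
    where
    x≡ : x ≡ x′ + d′
    x≡ = double-injective (+-cancelʳ-≡ d _ _ (trans (+-assoc x x d) eq))
    lemma : ∀ x d d′ → x + (d + d′) ≡ x + d′ + d
    lemma = solve-∀
  below-above : ∀ {x d x′ d′} → x + d < L → D + d ≡ L → x + x ≡ C + D → D + d′ ≡ L → C ≡ (x′ + d′) + (x′ + d′) + D → ∀ {P : Set} → P
  below-above {x} {d} {x′} {d′} y<L _ eq refl refl = contradiction
    (≤-trans (≤-trans (m≤n+m (D + d′) x′) (≤-reflexive (trans (lemma x′ D d′) (sym x≡)))) (m≤m+n x d)) (<⇒≱ y<L)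
    where
    lemma : ∀ x d d′ → x + (d + d′) ≡ x + d′ + d
    lemma = solve-∀
    lemma₂ : ∀ a d → a + a + d + d ≡ (a + d) + (a + d)
    lemma₂ = solve-∀
    x≡ : x ≡ x′ + d′ + D
    x≡ = double-injective (trans eq (lemma₂ (x′ + d′) D))
  go : Centre L x d C D → Centre L x′ d′ C D → x ≡ x′ × d ≡ d′
  go (near refl refl) (near eq refl) =
    double-injective (+-cancelʳ-≡ d _ _ (trans (+-assoc x x d) (trans eq (sym (+-assoc x′ x′ d))))) , refl
  go (below refl eq) (below eqL eq′) = double-injective (trans eq (sym eq′)) , +-cancelˡ-≡ D _ _ (sym eqL)
  go (above refl eq) (above eqL eq′) = +-cancelʳ-≡ d _ _ (trans y≡y′ (cong (x′ +_) (sym d≡d′))) , d≡d′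
    where
    d≡d′ = +-cancelˡ-≡ D _ _ (sym eqL)
    y≡y′ : x + d ≡ x′ + d′
    y≡y′ = double-injective (+-cancelʳ-≡ D _ _ (trans (sym eq) eq′))
  go (near p q) (below p′ q′) = near-below {x} {d} {x′} {d′} y′<L p q p′ q′
  go (below p q) (near p′ q′) = near-below {x′} {d′} {x} {d} y<L p′ q′ p q
  go (near p q) (above p′ q′) = near-above {x} {d} {x′} {d′} y<L p q p′ q′
  go (above p q) (near p′ q′) = near-above {x′} {d′} {x} {d} y′<L p′ q′ p q
  go (below p q) (above p′ q′) = below-above {x} {d} {x′} {d′} y<L p q p′ q′
  go (above p q) (below p′ q′) = below-above {x′} {d′} {x} {d} y′<L p′ q′ p q

-- D is the distance from 2v to C on a circle of circumference 2L.
record Dist (L v C D : ℕ) : Set where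
  constructor dist
  field
    direct : D ≤ ∣ v + v - C ∣
    around : D + ∣ v + v - C ∣ ≤ L + L
    tight  : ∣ v + v - C ∣ ≤ D ⊎ L + L ≤ D + ∣ v + v - C ∣

-- With `A = ∣ v + v - C ∣`, the fields of `Dist` say that `D` is the minimum of `A` and `2L - A`.
-- Bound `D` by whichever of the two expressions attains the minimum for `C′`, then apply the
-- triangle inequality.
Dist-lipschitz : ∀ {L v C C′ D D′} → Dist L v C D → Dist L v C′ D′ → D ≤ D′ + ∣ C - C′ ∣
Dist-lipschitz {L} {v} {C} {C′} {D} {D′} δ δ′ with Dist.tight δ′
... | inj₁ A′≤D′ = begin
  D                            ≤⟨ Dist.direct δ ⟩
  ∣ v + v - C ∣                ≤⟨ ∣-∣-triangle (v + v) C′ C ⟩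
  ∣ v + v - C′ ∣ + ∣ C′ - C ∣  ≤⟨ +-mono-≤ A′≤D′ (≤-reflexive (∣-∣-comm C′ C)) ⟩
  D′ + ∣ C - C′ ∣              ∎
  where open ≤-Reasoning
... | inj₂ 2L≤ = +-cancelʳ-≤ ∣ v + v - C ∣ D (D′ + ∣ C - C′ ∣) (begin
  D + ∣ v + v - C ∣                   ≤⟨ Dist.around δ ⟩
  L + L                               ≤⟨ 2L≤ ⟩
  D′ + ∣ v + v - C′ ∣                 ≤⟨ +-monoʳ-≤ D′ (∣-∣-triangle (v + v) C C′) ⟩
  D′ + (∣ v + v - C ∣ + ∣ C - C′ ∣)   ≡⟨ lemma D′ _ _ ⟩
  D′ + ∣ C - C′ ∣ + ∣ v + v - C ∣     ∎)
  where
  open ≤-Reasoning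
  lemma : ∀ a b c → a + (b + c) ≡ a + c + b
  lemma = solve-∀

straight : ∀ {L v C D} → D ≤ L → ∣ v + v - C ∣ ≡ D → Dist L v C D
straight D≤L refl = dist ≤-refl (+-mono-≤ D≤L D≤L) (inj₁ ≤-refl)

wrapped : ∀ {L v C D A} → D ≤ A → D + A ≡ L + L → ∣ v + v - C ∣ ≡ A → Dist L v C D
wrapped D≤A eq refl = dist D≤A (≤-reflexive eq) (inj₂ (≤-reflexive (sym eq)))

∣-∣-diffʳ : ∀ {a b} m → b ≡ a + m → ∣ a - b ∣ ≡ m
∣-∣-diffʳ {a} m refl = ∣m-m+n∣≡n a m

∣-∣-diffˡ : ∀ {a b} m → a ≡ b + m → ∣ a - b ∣ ≡ m
∣-∣-diffˡ {a} {b} m eq = trans (∣-∣-comm a b) (∣-∣-diffʳ m eq)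

Centre⇒Dist-lo : ∀ {L x d C D} → x + d < L → Centre L x d C D → Dist L x C D
Centre⇒Dist-lo {x = x} {d} y<L (near eq refl) =
  straight (≤-trans (m≤n+m d x) (<⇒≤ y<L)) (∣-∣-diffʳ d (trans eq (sym (+-assoc x x d))))
Centre⇒Dist-lo {d = d} {D = D} _ (below refl eq) = straight (m≤m+n D d) (∣-∣-diffˡ D eq)
Centre⇒Dist-lo {x = x} {d} {D = D} _ (above refl eq) =
  wrapped {A = d + d + D} (m≤n+m D (d + d)) (lemma D d) (∣-∣-diffʳ {x + x} (d + d + D) (trans eq (lemma₂ x d D)))
  where
  lemma : ∀ D d → D + (d + d + D) ≡ D + d + (D + d)
  lemma = solve-∀
  lemma₂ : ∀ x d D → (x + d) + (x + d) + D ≡ x + x + (d + d + D)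
  lemma₂ = solve-∀

Centre⇒Dist-hi : ∀ {L x d C D} → x + d < L → Centre L x d C D → Dist L (x + d) C D
Centre⇒Dist-hi {x = x} {d} y<L (near refl refl) =
  straight (≤-trans (m≤n+m d x) (<⇒≤ y<L)) (∣-∣-diffˡ d (lemma x d))
  where
  lemma : ∀ x d → (x + d) + (x + d) ≡ x + (x + d) + d
  lemma = solve-∀
Centre⇒Dist-hi {x = x} {d} {C} {D} _ (below refl eq) =
  wrapped {A = D + (d + d)} (m≤m+n D (d + d)) (lemma D d)
    (∣-∣-diffˡ (D + (d + d)) (trans (lemma₂ x d) (trans (cong (_+ (d + d)) eq) (+-assoc C D (d + d)))))
  where
  lemma : ∀ D d → D + (D + (d + d)) ≡ D + d + (D + d)
  lemma = solve-∀
  lemma₂ : ∀ x d → (x + d) + (x + d) ≡ x + x + (d + d)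
  lemma₂ = solve-∀
Centre⇒Dist-hi {d = d} {D = D} _ (above refl eq) = straight (m≤m+n D d) (∣-∣-diffʳ D eq)

Centre⇒offset≤ : ∀ {L x d C D} → x + d < L → Centre L x d C D → D ≤ L
Centre⇒offset≤ {x = x} {d} y<L (near _ refl) = ≤-trans (m≤n+m d x) (<⇒≤ y<L)
Centre⇒offset≤ {d = d} {D = D} _ (below refl _) = m≤m+n D d
Centre⇒offset≤ {d = d} {D = D} _ (above refl _) = m≤m+n D d

-- In each case the sum or the difference of `C` and `D` is twice an end of the edge.
Centre⇒parity : ∀ {L x d C D} → Centre L x d C D → parity D ≡ parity C
Centre⇒parity {x = x} {d} (near refl refl) = trans (twice d x) (cong parity (trans (+-comm d _) (+-assoc x x d)))
Centre⇒parity {x = x} {C = C} {D} (below _ eq) = trans (twice D C) (trans (cong parity (lemma D C))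
  (trans (cong (λ a → parity (C + a)) (sym eq)) (sym (twice C x))))
  where
  lemma : ∀ D C → D + (C + C) ≡ C + (C + D)
  lemma = solve-∀
Centre⇒parity {x = x} {d} {D = D} (above _ refl) = trans (twice D (x + d)) (cong parity (+-comm D _))

-- The vertex L plays the role of ∞: an edge {x , ∞} is treated as the loop {x , x}.
gap : ∀ {L} → Edge (suc L) → ℕ
gap {L} (edge i j _) with toℕ j <? L
... | yes _ = toℕ j ∸ toℕ i
... | no  _ = 0

low : ∀ {L} → Edge (suc L) → ℕ
low e = toℕ (Edge.lo e)

low+gap< : ∀ {L} (e : Edge (suc L)) → low e + gap e < L
low+gap< {L} (edge i j i<j) with toℕ j <? L
... | yes j<L = subst (_< L) (sym (m+[n∸m]≡n (<⇒≤ i<j))) j<L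
... | no  _   = subst (_< L) (sym (+-identityʳ (toℕ i))) (<-≤-trans i<j (≤-pred (F.toℕ<n j)))

-- A chord has positive gap since `i < j`, so gap 0 identifies the edges to ∞.
low-gap-injective : ∀ {L} {e e′ : Edge (suc L)} → low e ≡ low e′ → gap e ≡ gap e′ → e ≡ e′
low-gap-injective {L} {edge i j i<j} {edge i′ j′ i′<j′} i≡i′ eq with toℕ j <? L | toℕ j′ <? L
... | yes _ | yes _ = edge-≡ (F.toℕ-injective i≡i′) (F.toℕ-injective (begin
  toℕ j                        ≡⟨ m+[n∸m]≡n (<⇒≤ i<j) ⟨
  toℕ i + (toℕ j ∸ toℕ i)      ≡⟨ cong₂ _+_ i≡i′ eq ⟩
  toℕ i′ + (toℕ j′ ∸ toℕ i′)   ≡⟨ m+[n∸m]≡n (<⇒≤ i′<j′) ⟩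
  toℕ j′                       ∎))
  where open ≡-Reasoning
... | yes _ | no _ = contradiction (m∸n≡0⇒m≤n eq) (<⇒≱ i<j)
... | no _ | yes _ = contradiction (m∸n≡0⇒m≤n (sym eq)) (<⇒≱ i′<j′)
... | no j≮L | no j′≮L = edge-≡ (F.toℕ-injective i≡i′) (F.toℕ-injective (trans (≡L j j≮L) (sym (≡L j′ j′≮L))))
  where
  ≡L : ∀ (j : Fin (suc L)) → toℕ j ≮ L → toℕ j ≡ L
  ≡L j j≮L = ≤-antisym (≤-pred (F.toℕ<n j)) (≮⇒≥ j≮L)

incident⇒ : ∀ {n} {v : Fin n} {e} → T (incident v e) → v ≡ Edge.lo e ⊎ v ≡ Edge.hi e
incident⇒ {v = v} {edge i j _} inc with Equivalence.to (T-∨ {⌊ v F.≟ i ⌋}) inc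
... | inj₁ w = inj₁ (toWitness w)
... | inj₂ w = inj₂ (toWitness w)

incident-< : ∀ {L} {v : Fin (suc L)} {e} → toℕ v < L → T (incident v e) → toℕ v ≡ low e ⊎ toℕ v ≡ low e + gap e
incident-< {L} {v} {e@(edge i j i<j)} v<L inc with incident⇒ {v = v} {e} inc
... | inj₁ refl = inj₁ refl
... | inj₂ refl with toℕ j <? L
...   | yes _ = inj₂ (sym (m+[n∸m]≡n (<⇒≤ i<j)))
...   | no j≮L = contradiction v<L j≮L

incident-∞ : ∀ {L} {v : Fin (suc L)} {e} → toℕ v ≮ L → T (incident v e) → gap e ≡ 0
incident-∞ {L} {v} {e@(edge i j i<j)} v≮L inc with incident⇒ {v = v} {e} inc
... | inj₁ refl = contradiction (<-≤-trans i<j (≤-pred (F.toℕ<n j))) v≮L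
... | inj₂ refl with toℕ j <? L
...   | yes j<L = contradiction j<L v≮L
...   | no _ = refl

-- Orderings from sequences of centres

-- An edge in round k at offset D is scheduled at time (D + k n) / 2, rounded down; since all
-- D + k n have the same parity, rounding does not affect differences of times.
record Placement (L r w : ℕ) : Set where
  field
    centre offset round : Edge (suc L) → ℕ
    σ            : ℕ → ℕ
    timeParity   : Parity
    isCentre     : ∀ e → Centre L (low e) (gap e) (centre e) (offset e)
    round<       : ∀ e → round e < L
    σ-round      : ∀ e → σ (round e) ≡ centre e
    spread       : ∀ k u → ∣ σ k - σ (k + u * r) ∣ ≤ u * w
    parity-time  : ∀ e → parity (offset e + round e * suc L) ≡ timeParity

bit : Parity → ℕ
bit 0ℙ = 0
bit 1ℙ = 1

halves : ∀ m → m ≡ ⌊ m /2⌋ + ⌊ m /2⌋ + bit (parity m)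
halves zero          = refl
halves (suc zero)    = refl
halves (suc (suc m)) = cong suc (trans (cong suc (halves m)) (cong (_+ bit (parity m)) (sym (+-suc ⌊ m /2⌋ ⌊ m /2⌋))))

/-<⇒+multiple : ∀ a b r .{{_ : NonZero r}} → a % r ≡ b % r → a / r < b / r → ∃ λ u → b ≡ a + suc u * r
/-<⇒+multiple a b r eq a<b with m≤n⇒∃[o]m+o≡n a<b
... | u , eq/ = u , (begin
  b                                 ≡⟨ m≡m%n+[m/n]*n b r ⟩
  b % r + b / r * r                 ≡⟨ cong₂ (λ c i → c + i * r) (sym eq) (sym eq/) ⟩
  a % r + (suc (a / r) + u) * r     ≡⟨ lemma (a % r) (a / r) u r ⟩
  a % r + a / r * r + suc u * r     ≡⟨ cong (_+ suc u * r) (m≡m%n+[m/n]*n a r) ⟨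
  a + suc u * r                     ∎)
  where
  open ≡-Reasoning
  lemma : ∀ c i u r → c + (suc i + u) * r ≡ c + i * r + suc u * r
  lemma = solve-∀

%-≡⇒ : ∀ a b r .{{_ : NonZero r}} → a % r ≡ b % r →
  a ≡ b ⊎ (∃ λ u → b ≡ a + suc u * r) ⊎ (∃ λ u → a ≡ b + suc u * r)
%-≡⇒ a b r eq with <-cmp (a / r) (b / r)
... | tri≈ _ eq/ _ = inj₁ (trans (m≡m%n+[m/n]*n a r)
                       (trans (cong₂ (λ c i → c + i * r) eq eq/) (sym (m≡m%n+[m/n]*n b r))))
... | tri< a<b _ _ = inj₂ (inj₁ (/-<⇒+multiple a b r eq a<b))
... | tri> _ _ b<a = inj₂ (inj₂ (/-<⇒+multiple b a r (sym eq) b<a))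

module Build {L r w : ℕ} .{{_ : NonZero r}} (placement : Placement L r w) where

  open Placement placement

  time : Edge (suc L) → ℕ
  time e = offset e + round e * suc L

  pos : Edge (suc L) → ℕ
  pos e = ⌊ time e /2⌋

  time-pos : ∀ e → time e ≡ pos e + pos e + bit timeParity
  time-pos e = trans (halves (time e)) (cong (λ p → pos e + pos e + bit p) (parity-time e))

  offset≤ : ∀ e → offset e ≤ L
  offset≤ e = Centre⇒offset≤ (low+gap< e) (isCentre e)

  -- As `offset e ≤ L < n`, offset and round are the remainder and quotient of the time by `n`. The
  -- round determines the centre through `σ`, and centre and offset determine the edge.
  time-injective : ∀ {e e′} → time e ≡ time e′ → e ≡ e′
  time-injective {e} {e′} eq = low-gap-injective (proj₁ both) (proj₂ both)
    where
    offset≡ : offset e ≡ offset e′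
    offset≡ = begin
      offset e            ≡⟨ m≤n⇒m%n≡m (offset≤ e) ⟨
      offset e % suc L    ≡⟨ [m+kn]%n≡m%n (offset e) (round e) (suc L) ⟨
      time e % suc L      ≡⟨ cong (_% suc L) eq ⟩
      time e′ % suc L     ≡⟨ [m+kn]%n≡m%n (offset e′) (round e′) (suc L) ⟩
      offset e′ % suc L   ≡⟨ m≤n⇒m%n≡m (offset≤ e′) ⟩
      offset e′           ∎
      where open ≡-Reasoning
    round≡ : round e ≡ round e′
    round≡ = *-cancelʳ-≡ (round e) (round e′) (suc L)
      (+-cancelˡ-≡ (offset e) _ _ (trans eq (cong (_+ round e′ * suc L) (sym offset≡))))
    centre≡ : centre e ≡ centre e′
    centre≡ = trans (sym (σ-round e)) (trans (cong σ round≡) (σ-round e′))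
    both = Centre-injective (low+gap< e) (low+gap< e′) (isCentre e)
      (subst₂ (Centre L (low e′) (gap e′)) (sym centre≡) (sym offset≡) (isCentre e′))

  pos-injective : ∀ {e e′} → pos e ≡ pos e′ → e ≡ e′
  pos-injective {e} {e′} eq = time-injective (trans (time-pos e)
    (trans (cong (λ p → p + p + bit timeParity) eq) (sym (time-pos e′))))

  pos< : ∀ e → pos e < numEdges (suc L)
  pos< e = *-cancelˡ-< 2 (pos e) (numEdges (suc L)) (begin-strict
    2 * pos e                         ≡⟨ cong (pos e +_) (+-identityʳ (pos e)) ⟩
    pos e + pos e                     ≤⟨ m≤m+n _ _ ⟩
    pos e + pos e + bit timeParity    ≡⟨ time-pos e ⟨
    offset e + round e * suc L        <⟨ +-monoˡ-< (round e * suc L) (s≤s (offset≤ e)) ⟩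
    suc (round e) * suc L             ≤⟨ *-monoˡ-≤ (suc L) (round< e) ⟩
    L * suc L                         ≡⟨ *-comm L (suc L) ⟩
    suc L * L                         ≡⟨ 2*numEdges L ⟨
    2 * numEdges (suc L)              ∎)
    where open ≤-Reasoning

  place : Edge (suc L) → Fin (numEdges (suc L))
  place e = F.fromℕ< (pos< e)

  place-injective : ∀ {e e′} → place e ≡ place e′ → e ≡ e′
  place-injective eq = pos-injective (F.fromℕ<-injective _ _ _ _ eq)

  place-surjective : ∀ p → ∃ λ e → place e ≡ p
  place-surjective p with enumerate (suc L)
  ... | f , f-inj with injective⇒surjective (λ eq → f-inj (place-injective eq)) p
  ...   | i , eq = f i , eq

  ordering : Ordering (suc L)
  ordering = mk↔ₛ′ place (λ p → proj₁ (place-surjective p)) (λ p → proj₂ (place-surjective p))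
    (λ e → place-injective (proj₂ (place-surjective (place e))))

  -- In `r` rounds the doubled time gains `r * suc L` from the round number and loses at most `w`
  -- from the motion of the centre; what remains has to cover `s + s`.
  module _ {s : ℕ} (1≤w : 1 ≤ w) (2s+w≤rn : (s + s) + w ≤ r * suc L) where

    Later : Edge (suc L) → Edge (suc L) → Set
    Later e e′ = time e + (s + s) ≤ time e′

    Later⇒pos : ∀ {e e′} → Later e e′ → position ordering e + s ≤ position ordering e′
    Later⇒pos {e} {e′} h = subst₂ (λ a b → a + s ≤ b) (sym (F.toℕ-fromℕ< (pos< e))) (sym (F.toℕ-fromℕ< (pos< e′)))
      (*-cancelˡ-≤ 2 (+-cancelʳ-≤ (bit timeParity) _ _ (begin
        2 * (pos e + s) + bit timeParity              ≡⟨ lemma (pos e) s (bit timeParity) ⟩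
        pos e + pos e + bit timeParity + (s + s)      ≡⟨ cong (_+ (s + s)) (time-pos e) ⟨
        time e + (s + s)                              ≤⟨ h ⟩
        time e′                                       ≡⟨ time-pos e′ ⟩
        pos e′ + pos e′ + bit timeParity              ≡⟨ lemma₂ (pos e′) (bit timeParity) ⟩
        2 * pos e′ + bit timeParity                   ∎)))
      where
      open ≤-Reasoning
      lemma : ∀ p s b → 2 * (p + s) + b ≡ p + p + b + (s + s)
      lemma = solve-∀
      lemma₂ : ∀ p b → p + p + b ≡ 2 * p + b
      lemma₂ = solve-∀

    degree-≤ : ∀ v (index : Edge (suc L) → ℕ) →
      (∀ {e e′} → T (incident v e) → T (incident v e′) → index e ≡ index e′ → e ≡ e′) →
      (∀ {e e′} u → T (incident v e) → T (incident v e′) → index e′ ≡ index e + suc u * r → Later e e′) →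
      ∀ k → windowDeg ordering k s v ≤ r
    degree-≤ v index same later = windowDeg-≤ ordering s v (λ e → index e mod r) separated
      where
      separated : ∀ {e e′} → T (incident v e) → T (incident v e′) → index e mod r ≡ index e′ mod r →
        e ≡ e′ ⊎ position ordering e + s ≤ position ordering e′ ⊎ position ordering e′ + s ≤ position ordering e
      separated {e} {e′} inc inc′ eq with %-≡⇒ (index e) (index e′) r (F.fromℕ<-injective _ _ _ _ eq)
      ... | inj₁ eq′ = inj₁ (same inc inc′ eq′)
      ... | inj₂ (inj₁ (u , eq′)) = inj₂ (inj₁ (Later⇒pos {e} {e′} (later u inc inc′ eq′)))
      ... | inj₂ (inj₂ (u , eq′)) = inj₂ (inj₂ (Later⇒pos {e′} {e} (later u inc′ inc eq′)))

    stretch : ∀ u → suc u * w + (s + s) ≤ suc u * r * suc L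
    stretch u = begin
      suc u * w + (s + s)              ≤⟨ +-monoʳ-≤ (suc u * w) (m≤m+n (s + s) (u * (s + s))) ⟩
      suc u * w + suc u * (s + s)      ≡⟨ lemma u w s ⟩
      suc u * (s + s + w)              ≤⟨ *-monoʳ-≤ (suc u) 2s+w≤rn ⟩
      suc u * (r * suc L)              ≡⟨ *-assoc (suc u) r (suc L) ⟨
      suc u * r * suc L                ∎
      where
      open ≤-Reasoning
      lemma : ∀ u w s → suc u * w + suc u * (s + s) ≡ suc u * (s + s + w)
      lemma = solve-∀

    -- The offset of an edge at `v` is the distance from `v` to the centre of its round, so it
    -- changes no faster than the centre moves. For `u = 0` this leaves at most one edge at `v` in
    -- each round; for positive `u` it gives the separation in time.
    degree-≤-circle : ∀ v → toℕ v < L → ∀ k → windowDeg ordering k s v ≤ r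
    degree-≤-circle v v<L = degree-≤ v round same later
      where
      isDist : ∀ {e} → T (incident v e) → Dist L (toℕ v) (centre e) (offset e)
      isDist {e} inc with incident-< {v = v} {e} v<L inc
      ... | inj₁ eq = subst (λ x → Dist L x (centre e) (offset e)) (sym eq) (Centre⇒Dist-lo (low+gap< e) (isCentre e))
      ... | inj₂ eq = subst (λ x → Dist L x (centre e) (offset e)) (sym eq) (Centre⇒Dist-hi (low+gap< e) (isCentre e))
      lipschitz : ∀ {e e′} u → T (incident v e) → T (incident v e′) → round e′ ≡ round e + u * r →
                  offset e ≤ offset e′ + u * w
      lipschitz {e} {e′} u inc inc′ eq = ≤-trans (Dist-lipschitz (isDist {e} inc) (isDist {e′} inc′))
        (+-monoʳ-≤ (offset e′) (subst₂ (λ a b → ∣ a - b ∣ ≤ u * w) (σ-round e)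
          (trans (cong σ (sym eq)) (σ-round e′)) (spread (round e) u)))
      same-≤ : ∀ {e e′} → T (incident v e) → T (incident v e′) → round e ≡ round e′ → offset e ≤ offset e′
      same-≤ {e} {e′} inc inc′ eq = subst (offset e ≤_) (+-identityʳ _)
        (lipschitz {e} {e′} 0 inc inc′ (trans (sym eq) (sym (+-identityʳ _))))
      same : ∀ {e e′} → T (incident v e) → T (incident v e′) → round e ≡ round e′ → e ≡ e′
      same {e} {e′} inc inc′ eq = time-injective (cong₂ (λ a b → a + b * suc L)
        (≤-antisym (same-≤ {e} {e′} inc inc′ eq) (same-≤ {e′} {e} inc′ inc (sym eq))) eq)
      later : ∀ {e e′} u → T (incident v e) → T (incident v e′) → round e′ ≡ round e + suc u * r → Later e e′
      later {e} {e′} u inc inc′ eq = begin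
        offset e + round e * suc L + (s + s)                        ≤⟨ +-monoˡ-≤ (s + s) (+-monoˡ-≤ (round e * suc L) (lipschitz {e} {e′} (suc u) inc inc′ eq)) ⟩
        offset e′ + suc u * w + round e * suc L + (s + s)           ≡⟨ lemma (offset e′) (suc u * w) (round e * suc L) (s + s) ⟩
        offset e′ + (round e * suc L + (suc u * w + (s + s)))       ≤⟨ +-monoʳ-≤ (offset e′) (+-monoʳ-≤ (round e * suc L) (stretch u)) ⟩
        offset e′ + (round e * suc L + suc u * r * suc L)           ≡⟨ cong (offset e′ +_) (*-distribʳ-+ (suc L) (round e) (suc u * r)) ⟨
        offset e′ + (round e + suc u * r) * suc L                   ≡⟨ cong (λ k → offset e′ + k * suc L) eq ⟨
        time e′                                                     ∎
        where
        open ≤-Reasoning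
        lemma : ∀ a b c d → a + b + c + d ≡ a + (c + (b + d))
        lemma = solve-∀

    -- At ∞ only the offsets 0 and L = n - 1 occur, so up to an error of 1 the doubled times
    -- are multiples of n.
    visit : Edge (suc L) → ℕ
    visit e with offset e ≟ 0
    ... | yes _ = round e
    ... | no  _ = suc (round e)

    time-visit : ∀ {e} → gap e ≡ 0 → visit e * suc L ≡ time e ⊎ visit e * suc L ≡ suc (time e)
    time-visit {e} gap≡0 with offset e ≟ 0
    ... | yes D≡0 = inj₁ (cong (_+ round e * suc L) (sym D≡0))
    ... | no  D≢0 = inj₂ (cong (λ D → suc (D + round e * suc L)) (sym (D≡L (isCentre e))))
      where
      D≡L : Centre L (low e) (gap e) (centre e) (offset e) → offset e ≡ L
      D≡L (near _ eq)  = contradiction (trans eq gap≡0) D≢0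
      D≡L (below eq _) = trans (sym (+-identityʳ _)) (trans (cong (offset e +_) (sym gap≡0)) eq)
      D≡L (above eq _) = trans (sym (+-identityʳ _)) (trans (cong (offset e +_) (sym gap≡0)) eq)

    -- An edge of offset `L` in round `k` and one of offset 0 in round `k + 1` would share a visit
    -- number at ∞. Their times would be consecutive integers, which the common parity forbids.
    time≢1+time : ∀ e e′ → time e ≢ suc (time e′)
    time≢1+time e e′ eq = p≢p⁻¹ timeParity (trans (sym (parity-time e))
      (trans (cong parity eq) (trans (parity-suc (time e′)) (cong _⁻¹ (parity-time e′)))))
      where
      p≢p⁻¹ : ∀ p → p ≢ p ⁻¹
      p≢p⁻¹ 0ℙ ()
      p≢p⁻¹ 1ℙ ()

    degree-≤-∞ : ∀ v → toℕ v ≮ L → ∀ k → windowDeg ordering k s v ≤ r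
    degree-≤-∞ v v≮L = degree-≤ v visit
      (λ {e} {e′} inc inc′ → same {e} {e′} (loop {e} inc) (loop {e′} inc′))
      (λ {e} {e′} u inc inc′ → later {e} {e′} u (loop {e} inc) (loop {e′} inc′))
      where
      loop : ∀ {e} → T (incident v e) → gap e ≡ 0
      loop {e} = incident-∞ {v = v} {e} v≮L
      same : ∀ {e e′} → gap e ≡ 0 → gap e′ ≡ 0 → visit e ≡ visit e′ → e ≡ e′
      same {e} {e′} g g′ eq with time-visit {e} g | time-visit {e′} g′ | cong (_* suc L) eq
      ... | inj₁ t | inj₁ t′ | eq′ = time-injective (trans (sym t) (trans eq′ t′))
      ... | inj₁ t | inj₂ t′ | eq′ = contradiction (trans (sym t) (trans eq′ t′)) (time≢1+time e e′)
      ... | inj₂ t | inj₁ t′ | eq′ = contradiction (trans (sym t′) (trans (sym eq′) t)) (time≢1+time e′ e)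
      ... | inj₂ t | inj₂ t′ | eq′ = time-injective (suc-injective (trans (sym t) (trans eq′ t′)))
      time≤ : ∀ {e} → gap e ≡ 0 → time e ≤ visit e * suc L
      time≤ {e} g = [ (λ eq → ≤-reflexive (sym eq)) , (λ eq → ≤-trans (n≤1+n _) (≤-reflexive (sym eq))) ]′ (time-visit {e} g)
      ≤1+time : ∀ {e} → gap e ≡ 0 → visit e * suc L ≤ suc (time e)
      ≤1+time {e} g = [ (λ eq → ≤-trans (≤-reflexive eq) (n≤1+n _)) , ≤-reflexive ]′ (time-visit {e} g)
      later : ∀ {e e′} u → gap e ≡ 0 → gap e′ ≡ 0 → visit e′ ≡ visit e + suc u * r → Later e e′
      later {e} {e′} u g g′ eq = ≤-pred (begin
        suc (time e + (s + s))                          ≡⟨ +-suc (time e) (s + s) ⟨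
        -- The extra 1, by which a time may fall short of its multiple of `n`, is paid for by
        -- `1 ≤ w`.
        time e + (1 + (s + s))                          ≤⟨ +-mono-≤ (time≤ {e} g) (+-monoˡ-≤ (s + s) (≤-trans 1≤w (m≤m+n w (u * w)))) ⟩
        visit e * suc L + (suc u * w + (s + s))         ≤⟨ +-monoʳ-≤ (visit e * suc L) (stretch u) ⟩
        visit e * suc L + suc u * r * suc L             ≡⟨ *-distribʳ-+ (suc L) (visit e) (suc u * r) ⟨
        (visit e + suc u * r) * suc L                   ≡⟨ cong (_* suc L) eq ⟨
        visit e′ * suc L                                ≤⟨ ≤1+time {e′} g′ ⟩
        suc (time e′)                                   ∎)
        where open ≤-Reasoning

    good : s ≤ numEdges (suc L) → Good r ordering s
    good s≤N = s≤N , λ k _ v → degree v k (toℕ v <? L)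
      where
      degree : ∀ v k → Dec (toℕ v < L) → windowDeg ordering k s v ≤ r
      degree v k (yes v<L) = degree-≤-circle v v<L k
      degree v k (no  v≮L) = degree-≤-∞ v v≮L k

-- Choice of a centre for each edge, and placements according to the parities of `n` and `r`

below-centre : ∀ {L x d} → x + d < L → L ≤ x + (x + d) →
  Centre L x d (x + (x + d) ∸ L) (L ∸ d) × x + (x + d) ∸ L < L
below-centre {L} {x} {d} y<L L≤u = below D+d≡L (+-cancelʳ-≡ d _ _ (begin
    x + x + d                        ≡⟨ +-assoc x x d ⟩
    x + (x + d)                      ≡⟨ C+L≡u ⟨
    (x + (x + d) ∸ L) + L            ≡⟨ cong (x + (x + d) ∸ L +_) D+d≡L ⟨
    (x + (x + d) ∸ L) + (L ∸ d + d)  ≡⟨ +-assoc (x + (x + d) ∸ L) (L ∸ d) d ⟨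
    (x + (x + d) ∸ L) + (L ∸ d) + d  ∎))
  , +-cancelʳ-< L _ _ (subst (_< L + L) (sym C+L≡u) (+-mono-≤-< (≤-trans (m≤m+n x d) (<⇒≤ y<L)) y<L))
  where
  open ≡-Reasoning
  D+d≡L = m∸n+n≡m (≤-trans (m≤n+m d x) (<⇒≤ y<L))
  C+L≡u = m∸n+n≡m L≤u

-- The two antipodal choices of `C` differ by `L` modulo `2L`, so one of them lies below `L`.
firstHalf-centre : ∀ {L x d} → x + d < L → ∃ λ C → ∃ λ D → Centre L x d C D × C < L
firstHalf-centre {L} {x} {d} y<L with <-≤-connex (x + (x + d)) L
... | inj₁ u<L = _ , _ , near refl refl , u<L
... | inj₂ L≤u = _ , _ , below-centre y<L L≤u

even-half : ∀ {m} → parity m ≡ 0ℙ → m ≡ ⌊ m /2⌋ + ⌊ m /2⌋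
even-half {m} even = trans (halves m) (trans (cong (λ p → ⌊ m /2⌋ + ⌊ m /2⌋ + bit p) even) (+-identityʳ _))

double-cancel-< : ∀ {a b} → a + a < b + b → a < b
double-cancel-< {a} {b} h = ≰⇒> λ b≤a → <⇒≱ h (+-mono-≤ b≤a b≤a)

-- For odd `L` the two antipodal choices of `C` have opposite parities; the even one puts the centre
-- at a vertex. `near` has `D = d` and is taken for even `d`; otherwise `D = L - d` is even, and
-- `below` or `above` is taken so that `C` stays under `2L`.
even-centre : ∀ {L x d} → parity L ≡ 1ℙ → x + d < L → ∃ λ a → ∃ λ D → Centre L x d (a + a) D × a < L
even-centre {L} {x} {d} L-odd y<L = finish (split (parity d) refl)
  where
  Even : Set
  Even = ∃ λ C → ∃ λ D → Centre L x d C D × parity D ≡ 0ℙ × C < L + L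
  L∸d-even : parity d ≡ 1ℙ → parity (L ∸ d) ≡ 0ℙ
  L∸d-even d-odd = lemma (parity (L ∸ d)) (begin
    parity (L ∸ d) ⊕ 1ℙ         ≡⟨ cong (parity (L ∸ d) ⊕_) d-odd ⟨
    parity (L ∸ d) ⊕ parity d   ≡⟨ ℙ.+-homo-+ (L ∸ d) d ⟨
    parity (L ∸ d + d)          ≡⟨ cong parity (m∸n+n≡m (≤-trans (m≤n+m d x) (<⇒≤ y<L))) ⟩
    parity L                    ≡⟨ L-odd ⟩
    1ℙ                          ∎)
    where
    open ≡-Reasoning
    lemma : ∀ p → p ⊕ 1ℙ ≡ 1ℙ → p ≡ 0ℙ
    lemma 0ℙ _ = refl
  split : ∀ p → parity d ≡ p → Even
  split 0ℙ d-even = _ , _ , near refl refl , d-even , +-mono-≤-< (≤-trans (m≤m+n x d) (<⇒≤ y<L)) y<L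
  split 1ℙ d-odd with <-≤-connex (x + (x + d)) L
  ... | inj₁ u<L = _ , _ , above D+d≡L refl , L∸d-even d-odd , (begin-strict
    (x + d) + (x + d) + (L ∸ d)     ≡⟨ lemma x d (L ∸ d) ⟩
    x + (x + d) + (L ∸ d + d)       ≡⟨ cong (x + (x + d) +_) D+d≡L ⟩
    x + (x + d) + L                 <⟨ +-monoˡ-< L u<L ⟩
    L + L                           ∎)
    where
    open ≤-Reasoning
    D+d≡L = m∸n+n≡m (≤-trans (m≤n+m d x) (<⇒≤ y<L))
    lemma : ∀ x d D → (x + d) + (x + d) + D ≡ x + (x + d) + (D + d)
    lemma = solve-∀
  ... | inj₂ L≤u with below-centre y<L L≤u
  ...   | centre , C<L = _ , _ , centre , L∸d-even d-odd , <-≤-trans C<L (m≤m+n L L)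
  finish : Even → ∃ λ a → ∃ λ D → Centre L x d (a + a) D × a < L
  finish (C , D , centre , D-even , C<2L) = ⌊ C /2⌋ , D , subst (λ C → Centre L x d C D) C≡ centre ,
    double-cancel-< (subst (_< L + L) C≡ C<2L)
    where
    C≡ = even-half (trans (sym (Centre⇒parity centre)) D-even)

⌊m+n+n/2⌋≡⌊m/2⌋+n : ∀ m n → ⌊ m + (n + n) /2⌋ ≡ ⌊ m /2⌋ + n
⌊m+n+n/2⌋≡⌊m/2⌋+n zero n          = sym (n≡⌊n+n/2⌋ n)
⌊m+n+n/2⌋≡⌊m/2⌋+n (suc zero) n    = sym (n≡⌈n+n/2⌉ n)
⌊m+n+n/2⌋≡⌊m/2⌋+n (suc (suc m)) n = cong suc (⌊m+n+n/2⌋≡⌊m/2⌋+n m n)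

double-spread : ∀ {a b u} c → ∣ a - b ∣ ≤ u → ∣ c + (a + a) - c + (b + b) ∣ ≤ u * 2
double-spread {a} {b} {u} c h = begin
  ∣ c + (a + a) - c + (b + b) ∣   ≡⟨ ∣m+n-m+o∣≡∣n-o∣ c (a + a) (b + b) ⟩
  ∣ a + a - b + b ∣               ≡⟨ cong₂ ∣_-_∣ (lemma a) (lemma b) ⟩
  ∣ a * 2 - b * 2 ∣               ≡⟨ *-distribʳ-∣-∣ 2 a b ⟨
  ∣ a - b ∣ * 2                   ≤⟨ *-monoˡ-≤ 2 h ⟩
  u * 2                           ∎
  where
  open ≤-Reasoning
  lemma : ∀ a → a + a ≡ a * 2
  lemma = solve-∀

parity-D+Kn : ∀ D K n → parity (D + K * n) ≡ parity D ⊕ (parity K ⊛ parity n)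
parity-D+Kn D K n = trans (ℙ.+-homo-+ D (K * n)) (cong (parity D ⊕_) (ℙ.*-homo-* K n))

-- For odd `n` the time has the parity of `C + k`, which `Alternating` keeps constant. Here `C`
-- itself is arranged in columns and moves by 1 in `r` rounds, so `w = 1`.
placement-oddOrder-oddDegree : ∀ L r .{{_ : NonZero r}} → parity L ≡ 0ℙ → parity r ≡ 1ℙ → Placement L r 1
placement-oddOrder-oddDegree L r L-even r-odd = record
  { centre      = C
  ; offset      = D
  ; round       = K
  ; σ           = σ
  ; timeParity  = parity q
  ; isCentre    = λ e → proj₁ (proj₂ (proj₂ (loc e)))
  ; round<      = λ e → proj₁ (proj₂ (rnd e))
  ; σ-round     = λ e → proj₂ (proj₂ (rnd e))
  ; spread      = λ k u → ≤-trans (σ-spread k u) (≤-reflexive (sym (*-identityʳ u)))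
  ; parity-time = λ e → begin
      parity (D e + K e * suc L)                ≡⟨ parity-D+Kn (D e) (K e) (suc L) ⟩
      parity (D e) ⊕ (parity (K e) ⊛ parity (suc L)) ≡⟨ cong₂ (λ a b → a ⊕ (parity (K e) ⊛ b)) (Centre⇒parity (proj₁ (proj₂ (proj₂ (loc e))))) (trans (parity-suc L) (cong _⁻¹ L-even)) ⟩
      parity (C e) ⊕ (parity (K e) ⊛ 1ℙ)        ≡⟨ cong (parity (C e) ⊕_) (ℙ.*-identityʳ (parity (K e))) ⟩
      parity (C e) ⊕ parity (K e)               ≡⟨ cong (λ c → parity c ⊕ parity (K e)) (proj₂ (proj₂ (rnd e))) ⟨
      parity (σ (K e)) ⊕ parity (K e)           ≡⟨ ℙ.+-homo-+ (σ (K e)) (K e) ⟨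
      parity (σ (K e) + K e)                    ≡⟨ σ-parity (proj₁ (proj₂ (rnd e))) ⟩
      parity q                                  ∎
  }
  where
  open ≡-Reasoning
  open Columns L r
  open Alternating L-even r-odd
  open Arranged flips
  loc : ∀ (e : Edge (suc L)) → ∃ λ C → ∃ λ D → Centre L (low e) (gap e) C D × C < L
  loc e = firstHalf-centre (low+gap< e)
  C D K : Edge (suc L) → ℕ
  C e = proj₁ (loc e)
  D e = proj₁ (proj₂ (loc e))
  rnd : ∀ e → ∃ λ k → k < L × σ k ≡ C e
  rnd e = σ-surjective (proj₂ (proj₂ (proj₂ (loc e))))
  K e = proj₁ (rnd e)

-- Adding `r = R + R` preserves the parity of `k`, so `C` can be given the parity of `k` directly:
-- `σ₂` keeps the last bit and arranges the halves, with `m` values in `R` columns. A unit step of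
-- the half moves `C` by 2.
placement-oddOrder-evenDegree : ∀ m R .{{_ : NonZero R}} → Placement (m + m) (R + R) 2
placement-oddOrder-evenDegree m R = record
  { centre      = C
  ; offset      = D
  ; round       = K
  ; σ           = σ₂
  ; timeParity  = 0ℙ
  ; isCentre    = λ e → proj₁ (proj₂ (proj₂ (loc e)))
  ; round<      = round<
  ; σ-round     = σ-round
  ; spread      = spread
  ; parity-time = λ e → begin
      parity (D e + K e * suc (m + m))                     ≡⟨ parity-D+Kn (D e) (K e) (suc (m + m)) ⟩
      parity (D e) ⊕ (parity (K e) ⊛ parity (suc (m + m))) ≡⟨ cong₂ _⊕_ (Centre⇒parity (proj₁ (proj₂ (proj₂ (loc e)))))
                                                               (cong₂ _⊛_ (parity-K e) (trans (parity-suc (m + m)) (cong _⁻¹ (parity-m+m m)))) ⟩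
      parity (C e) ⊕ (parity (C e) ⊛ 1ℙ)                   ≡⟨ cong (parity (C e) ⊕_) (ℙ.*-identityʳ (parity (C e))) ⟩
      parity (C e) ⊕ parity (C e)                          ≡⟨ ℙ.p+p≡0ℙ (parity (C e)) ⟩
      0ℙ                                                   ∎
  }
  where
  open ≡-Reasoning
  open Columns m R
  open Arranged (const false)
  σ₂ : ℕ → ℕ
  σ₂ k = bit (parity k) + (σ ⌊ k /2⌋ + σ ⌊ k /2⌋)
  loc : ∀ (e : Edge (suc (m + m))) → ∃ λ C → ∃ λ D → Centre (m + m) (low e) (gap e) C D × C < m + m
  loc e = firstHalf-centre (low+gap< e)
  C D H K : Edge (suc (m + m)) → ℕ
  C e = proj₁ (loc e)
  D e = proj₁ (proj₂ (loc e))
  rnd : ∀ e → ∃ λ k → k < m × σ k ≡ ⌊ C e /2⌋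
  rnd e = σ-surjective (double-cancel-< (≤-<-trans
    (≤-trans (m≤m+n _ _) (≤-reflexive (sym (halves (C e))))) (proj₂ (proj₂ (proj₂ (loc e))))))
  H e = proj₁ (rnd e)
  K e = bit (parity (C e)) + (H e + H e)
  bit≤1 : ∀ p → bit p ≤ 1
  bit≤1 0ℙ = z≤n
  bit≤1 1ℙ = s≤s z≤n
  parity-bit : ∀ p → parity (bit p) ≡ p
  parity-bit 0ℙ = refl
  parity-bit 1ℙ = refl
  ⌊bit/2⌋ : ∀ p → ⌊ bit p /2⌋ ≡ 0
  ⌊bit/2⌋ 0ℙ = refl
  ⌊bit/2⌋ 1ℙ = refl
  parity-K : ∀ e → parity (K e) ≡ parity (C e)
  parity-K e = trans (sym (twice (bit (parity (C e))) (H e))) (parity-bit (parity (C e)))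
  round< : ∀ e → K e < m + m
  round< e = <-≤-trans (s≤s (+-monoˡ-≤ _ (bit≤1 (parity (C e)))))
    (subst (_≤ m + m) (cong suc (+-suc (H e) (H e))) (+-mono-≤ (proj₁ (proj₂ (rnd e))) (proj₁ (proj₂ (rnd e)))))
  σ-round : ∀ e → σ₂ (K e) ≡ C e
  σ-round e = begin
    σ₂ (K e)                                      ≡⟨ cong₂ (λ p h → bit p + (σ h + σ h)) (parity-K e)
                                                       (trans (⌊m+n+n/2⌋≡⌊m/2⌋+n (bit (parity (C e))) (H e)) (cong (_+ H e) (⌊bit/2⌋ (parity (C e))))) ⟩
    bit (parity (C e)) + (σ (H e) + σ (H e))      ≡⟨ cong (λ a → bit (parity (C e)) + (a + a)) (proj₂ (proj₂ (rnd e))) ⟩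
    bit (parity (C e)) + (⌊ C e /2⌋ + ⌊ C e /2⌋)  ≡⟨ +-comm (bit (parity (C e))) _ ⟩
    ⌊ C e /2⌋ + ⌊ C e /2⌋ + bit (parity (C e))    ≡⟨ halves (C e) ⟨
    C e                                           ∎
  spread : ∀ k u → ∣ σ₂ k - σ₂ (k + u * (R + R)) ∣ ≤ u * 2
  spread k u = subst₂ (λ p h → ∣ σ₂ k - bit p + (σ h + σ h) ∣ ≤ u * 2)
    (trans (twice k (u * R)) (cong (λ x → parity (k + x)) (sym (*-distribˡ-+ u R R))))
    (trans (sym (⌊m+n+n/2⌋≡⌊m/2⌋+n k (u * R))) (cong (λ x → ⌊ k + x /2⌋) (sym (*-distribˡ-+ u R R))))
    (double-spread {σ ⌊ k /2⌋} {σ (⌊ k /2⌋ + u * R)} (bit (parity k)) (σ-spread ⌊ k /2⌋ u))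

-- For even `n` the term `k * n` is even, so the time has the parity of `C`. With all centres at
-- vertices it is even, whatever the directions of the columns.
placement-evenOrder : ∀ L r .{{_ : NonZero r}} → parity L ≡ 1ℙ → Placement L r 2
placement-evenOrder L r L-odd = record
  { centre      = λ e → A e + A e
  ; offset      = D
  ; round       = K
  ; σ           = λ k → σ k + σ k
  ; timeParity  = 0ℙ
  ; isCentre    = λ e → proj₁ (proj₂ (proj₂ (loc e)))
  ; round<      = λ e → proj₁ (proj₂ (rnd e))
  ; σ-round     = λ e → cong (λ a → a + a) (proj₂ (proj₂ (rnd e)))
  ; spread      = λ k u → double-spread {σ k} {σ (k + u * r)} 0 (σ-spread k u)
  ; parity-time = λ e → begin
      parity (D e + K e * suc L)                     ≡⟨ parity-D+Kn (D e) (K e) (suc L) ⟩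
      parity (D e) ⊕ (parity (K e) ⊛ parity (suc L)) ≡⟨ cong₂ (λ a b → a ⊕ (parity (K e) ⊛ b))
                                                          (trans (Centre⇒parity (proj₁ (proj₂ (proj₂ (loc e))))) (parity-m+m (A e)))
                                                          (trans (parity-suc L) (cong _⁻¹ L-odd)) ⟩
      parity (K e) ⊛ 0ℙ                              ≡⟨ ℙ.*-zeroʳ (parity (K e)) ⟩
      0ℙ                                             ∎
  }
  where
  open ≡-Reasoning
  open Columns L r
  open Arranged (const false)
  loc : ∀ (e : Edge (suc L)) → ∃ λ a → ∃ λ D → Centre L (low e) (gap e) (a + a) D × a < L
  loc e = even-centre L-odd (low+gap< e)
  A D K : Edge (suc L) → ℕ
  A e = proj₁ (loc e)
  D e = proj₁ (proj₂ (loc e))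
  rnd : ∀ e → ∃ λ k → k < L × σ k ≡ A e
  rnd e = σ-surjective (proj₂ (proj₂ (proj₂ (loc e))))
  K e = proj₁ (rnd e)

-- The lower bound

goodOrdering : ∀ {L r w s} .{{_ : NonZero r}} → Placement L r w → 1 ≤ w → s + s + w ≤ r * suc L → r ≤ L →
  Σ (Ordering (suc L)) λ ℓ → Good r ℓ s
goodOrdering {L} {r} {w} {s} placement 1≤w fits r≤L = ordering , good 1≤w fits (*-cancelˡ-≤ 2 (begin
  2 * s                  ≡⟨ cong (s +_) (+-identityʳ s) ⟩
  s + s                  ≤⟨ m≤m+n (s + s) w ⟩
  s + s + w              ≤⟨ fits ⟩
  r * suc L              ≤⟨ *-monoˡ-≤ (suc L) r≤L ⟩
  L * suc L              ≡⟨ *-comm L (suc L) ⟩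
  suc L * L              ≡⟨ 2*numEdges L ⟨
  2 * numEdges (suc L)   ∎))
  where
  open ≤-Reasoning
  open Build placement

-- The two placements with `w = 2` occur when `r * n` is even; there the odd number `s + s + 1`
-- cannot equal `r * n`, and the missing unit is gained.
even⇒2+ : ∀ {s N} → parity N ≡ 0ℙ → s + s + 1 ≤ N → s + s + 2 ≤ N
even⇒2+ {s} {N} even h = subst (_≤ N) (sym (+-suc (s + s) 1)) (≤∧≢⇒< h odd≢)
  where
  odd≢ : s + s + 1 ≢ N
  odd≢ eq = contradiction (trans (sym even) (trans (cong parity (sym eq))
    (trans (cong parity (+-comm (s + s) 1)) (sym (twice 1 s))))) λ ()

lowerBound : ∀ L r s → 1 ≤ r → r ≤ L → s + s + 1 ≤ r * suc L → Σ (Ordering (suc L)) λ ℓ → Good r ℓ s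
lowerBound L r@(suc _) s _ r≤L fits = byParity (parity L) (parity r) refl refl
  where
  rn-even : parity r ⊛ parity (suc L) ≡ 0ℙ → parity (r * suc L) ≡ 0ℙ
  rn-even = trans (ℙ.*-homo-* r (suc L))
  byParity : ∀ p p′ → parity L ≡ p → parity r ≡ p′ → Σ (Ordering (suc L)) λ ℓ → Good r ℓ s
  byParity 1ℙ _ L-odd _ = goodOrdering (placement-evenOrder L r L-odd) (s≤s z≤n) (even⇒2+ {s} (rn-even
    (trans (cong (parity r ⊛_) (trans (parity-suc L) (cong _⁻¹ L-odd))) (ℙ.*-zeroʳ (parity r)))) fits) r≤L
  byParity 0ℙ 1ℙ L-even r-odd = goodOrdering (placement-oddOrder-oddDegree L r L-even r-odd) (s≤s z≤n) fits r≤L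
  byParity 0ℙ 0ℙ L-even r-even = goodOrdering
    (subst₂ (λ L r → Placement L r 2) (sym (even-half L-even)) (sym (even-half r-even))
      (placement-oddOrder-evenDegree ⌊ L /2⌋ ⌊ r /2⌋ {{≢-nonZero half≢0}}))
    (s≤s z≤n) (even⇒2+ {s} (rn-even (cong (_⊛ parity (suc L)) r-even)) fits) r≤L
    where
    half≢0 : ⌊ r /2⌋ ≢ 0
    half≢0 eq = contradiction (trans (even-half {r} r-even) (cong (λ h → h + h) eq)) λ ()

-- The upper bound

⟦_⟧ : Bool → ℕ
⟦ b ⟧ = if b then 1 else 0

length-filterᵇ-tabulate : ∀ {a} {A : Set a} {n} (P : A → Bool) (f : Fin n → A) →
  length (filterᵇ P (tabulate f)) ≡ sum (λ i → ⟦ P (f i) ⟧)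
length-filterᵇ-tabulate {n = zero}  P f = refl
length-filterᵇ-tabulate {n = suc n} P f with P (f F.zero)
... | true  = cong suc (length-filterᵇ-tabulate P (f ∘ F.suc))
... | false = length-filterᵇ-tabulate P (f ∘ F.suc)

sum-≤ : ∀ {n r} (f : Fin n → ℕ) → (∀ i → f i ≤ r) → sum f ≤ n * r
sum-≤ {zero}  f f≤r = z≤n
sum-≤ {suc n} f f≤r = +-mono-≤ (f≤r F.zero) (sum-≤ (f ∘ F.suc) (f≤r ∘ F.suc))

sum-saturated : ∀ {n r} (f : Fin n → ℕ) → (∀ i → f i ≤ r) → n * r ≤ sum f → ∀ i → r ≤ f i
sum-saturated {suc n} {r} f f≤r h F.zero =
  +-cancelʳ-≤ (n * r) r (f F.zero) (≤-trans h (+-monoʳ-≤ (f F.zero) (sum-≤ (f ∘ F.suc) (f≤r ∘ F.suc))))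
sum-saturated {suc n} {r} f f≤r h (F.suc i) =
  sum-saturated (f ∘ F.suc) (f≤r ∘ F.suc) (+-cancelˡ-≤ r (n * r) _ (≤-trans h (+-monoˡ-≤ _ (f≤r F.zero)))) i

sum-⟦≟⟧ : ∀ {n} (i : Fin n) → sum (λ v → ⟦ ⌊ v F.≟ i ⌋ ⟧) ≡ 1
sum-⟦≟⟧ {suc n} F.zero    = cong suc (sum-replicate-zero n)
sum-⟦≟⟧ {suc n} (F.suc i) = trans (sum-cong-≗ suc≟suc) (sum-⟦≟⟧ i)
  where
  suc≟suc : ∀ v → ⟦ ⌊ F.suc v F.≟ F.suc i ⌋ ⟧ ≡ ⟦ ⌊ v F.≟ i ⌋ ⟧
  suc≟suc v with v F.≟ i
  ... | yes _ = refl
  ... | no  _ = refl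

sum-incident : ∀ {n} (e : Edge n) → sum (λ v → ⟦ incident v e ⟧) ≡ 2
sum-incident {n} (edge i j i<j) = trans (sum-cong-≗ disjoint)
  (trans (∑-distrib-+ (λ v → ⟦ ⌊ v F.≟ i ⌋ ⟧) (λ v → ⟦ ⌊ v F.≟ j ⌋ ⟧)) (cong₂ _+_ (sum-⟦≟⟧ i) (sum-⟦≟⟧ j)))
  where
  disjoint : ∀ v → ⟦ ⌊ v F.≟ i ⌋ ∨ ⌊ v F.≟ j ⌋ ⟧ ≡ ⟦ ⌊ v F.≟ i ⌋ ⟧ + ⟦ ⌊ v F.≟ j ⌋ ⟧
  disjoint v with v F.≟ i | v F.≟ j
  ... | yes refl | yes refl = contradiction i<j (<-irrefl refl)
  ... | yes _    | no _     = refl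
  ... | no _     | _        = refl

sum-⟦<⟧ : ∀ {N} s → s ≤ N → sum {N} (λ p → ⟦ toℕ p <ᵇ s ⟧) ≡ s
sum-⟦<⟧ {N} zero    _         = sum-replicate-zero N
sum-⟦<⟧     (suc s) (s≤s s≤N) = cong suc (sum-⟦<⟧ s s≤N)

sum-prefix : ∀ {N} (h : Fin N → Bool) (i : Fin N) →
  sum (λ p → ⟦ (toℕ p <ᵇ toℕ i) ∧ h p ⟧) + ⟦ h i ⟧ ≡ sum (λ p → ⟦ (toℕ p <ᵇ suc (toℕ i)) ∧ h p ⟧)
sum-prefix {suc N} h F.zero    = trans (cong (_+ ⟦ h F.zero ⟧) (sum-replicate-zero N))
  (trans (sym (+-identityʳ _)) (cong (⟦ h F.zero ⟧ +_) (sym (sum-replicate-zero N))))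
sum-prefix {suc N} h (F.suc i) = trans (+-assoc ⟦ h F.zero ⟧ _ _) (cong (⟦ h F.zero ⟧ +_) (sum-prefix (h ∘ F.suc) i))

-- This is `windowDeg` as a sum, with `numEdges n` generalised to a variable `N` so that the first
-- position can be split off.
degree : ∀ {n N} → (Fin N → Edge n) → ℕ → ℕ → Fin n → ℕ
degree f k s v = sum (λ p → ⟦ (k ≤ᵇ toℕ p) ∧ (toℕ p <ᵇ k + s) ∧ incident v (f p) ⟧)

-- Double counting: exchange the sums over vertices and positions, and use that each edge has two
-- ends.
sum-degree : ∀ {n N} (f : Fin N → Edge n) s → s ≤ N → sum (degree f 0 s) ≡ s + s
sum-degree {n} {N} f s s≤N = begin
  sum (λ v → sum (λ p → ⟦ (toℕ p <ᵇ s) ∧ incident v (f p) ⟧))    ≡⟨ ∑-comm {n} {N} _ ⟩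
  sum (λ p → sum (λ v → ⟦ (toℕ p <ᵇ s) ∧ incident v (f p) ⟧))    ≡⟨ sum-cong-≗ (λ p → ends (toℕ p <ᵇ s) (f p)) ⟩
  sum {N} (λ p → ⟦ toℕ p <ᵇ s ⟧ + ⟦ toℕ p <ᵇ s ⟧)                ≡⟨ ∑-distrib-+ {N} _ _ ⟩
  sum {N} (λ p → ⟦ toℕ p <ᵇ s ⟧) + sum {N} (λ p → ⟦ toℕ p <ᵇ s ⟧) ≡⟨ cong₂ _+_ (sum-⟦<⟧ s s≤N) (sum-⟦<⟧ s s≤N) ⟩
  s + s                                                          ∎
  where
  open ≡-Reasoning
  ends : ∀ b (e : Edge n) → sum (λ v → ⟦ b ∧ incident v e ⟧) ≡ ⟦ b ⟧ + ⟦ b ⟧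
  ends true  e = sum-incident e
  ends false e = sum-replicate-zero n

-- Both sides count the edges at `v` in positions 0 to `suc (toℕ i)`; one splits off the last
-- position, the other the first.
degree-shift : ∀ {n N} (f : Fin (suc N) → Edge n) (i : Fin N) v →
  degree f 0 (suc (toℕ i)) v + ⟦ incident v (f (F.suc i)) ⟧ ≡ ⟦ incident v (f F.zero) ⟧ + degree f 1 (suc (toℕ i)) v
degree-shift f i v = trans (+-assoc ⟦ incident v (f F.zero) ⟧ _ _)
  (cong (⟦ incident v (f F.zero) ⟧ +_) (sum-prefix (λ p → incident v (f (F.suc p))) i))

incident-⊆⇒≡ : ∀ {n} {e e′ : Edge n} → (∀ v → T (incident v e) → T (incident v e′)) → e ≡ e′
incident-⊆⇒≡ {n} {e@(edge i j i<j)} {e′@(edge i′ j′ i′<j′)} sub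
  with incident⇒ {v = i} {e′} (sub i (lo-incident e)) | incident⇒ {v = j} {e′} (sub j (hi-incident e))
  where
  lo-incident : (e : Edge n) → T (incident (Edge.lo e) e)
  lo-incident (edge i j _) = Equivalence.from (T-∨ {⌊ i F.≟ i ⌋}) (inj₁ (fromWitness {a? = i F.≟ i} refl))
  hi-incident : (e : Edge n) → T (incident (Edge.hi e) e)
  hi-incident (edge i j _) = Equivalence.from (T-∨ {⌊ j F.≟ i ⌋}) (inj₂ (fromWitness {a? = j F.≟ j} refl))
... | inj₁ i≡i′ | inj₂ j≡j′ = edge-≡ i≡i′ j≡j′
... | inj₁ refl | inj₁ refl = contradiction i<j (<-irrefl refl)
... | inj₂ refl | inj₂ refl = contradiction i<j (<-irrefl refl)
... | inj₂ refl | inj₁ refl = contradiction i<j (<⇒≯ i′<j′)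

-- If the window starting at 0 is r-regular, the edge that enters the next window can only
-- have both its ends where the leaving edge had its own.
regular-impossible : ∀ {n N r s} (f : Fin N → Edge n) → Injective _≡_ _≡_ f → 1 ≤ s → 1 + s ≤ N →
  (∀ v → r ≤ degree f 0 s v) → (∀ v → degree f 1 s v ≤ r) → ∀ {P : Set} → P
regular-impossible {N = suc N} {r} {suc s} f f-inj _ (s≤s s<N) lower upper =
  contradiction (f-inj (incident-⊆⇒≡ (λ v → leaves v))) λ ()
  where
  i = F.fromℕ< s<N
  ⟦⟧-T : ∀ {b b′} → ⟦ b ⟧ ≤ ⟦ b′ ⟧ → T b → T b′
  ⟦⟧-T {true} {true} _ _ = _
  leaves : ∀ v → T (incident v (f (F.suc i))) → T (incident v (f F.zero))
  leaves v = ⟦⟧-T (+-cancelˡ-≤ r _ _ (begin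
    r + ⟦ incident v (f (F.suc i)) ⟧                             ≤⟨ +-monoˡ-≤ _ (lower v) ⟩
    degree f 0 (suc s) v + ⟦ incident v (f (F.suc i)) ⟧          ≡⟨ cong (λ m → degree f 0 (suc m) v + ⟦ incident v (f (F.suc i)) ⟧) (F.toℕ-fromℕ< s<N) ⟨
    degree f 0 (suc (toℕ i)) v + ⟦ incident v (f (F.suc i)) ⟧    ≡⟨ degree-shift f i v ⟩
    ⟦ incident v (f F.zero) ⟧ + degree f 1 (suc (toℕ i)) v       ≡⟨ cong (λ m → ⟦ incident v (f F.zero) ⟧ + degree f 1 (suc m) v) (F.toℕ-fromℕ< s<N) ⟩
    ⟦ incident v (f F.zero) ⟧ + degree f 1 (suc s) v             ≤⟨ +-monoʳ-≤ _ (upper v) ⟩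
    ⟦ incident v (f F.zero) ⟧ + r                                ≡⟨ +-comm _ r ⟩
    r + ⟦ incident v (f F.zero) ⟧                                ∎))
    where open ≤-Reasoning

-- Counting ends gives `s + s ≤ r * suc L`. Under equality no degree in the first window can fall
-- below `r`, and `r < L` makes `s` smaller than the number of edges, so a window starting at 1
-- exists and `regular-impossible` applies.
upperBound : ∀ L r s (ℓ : Ordering (suc L)) → 1 ≤ r → r < L → Good r ℓ s → s + s < r * suc L
upperBound L r s ℓ 1≤r r<L (s≤N , good) = ≤∧≢⇒< 2s≤rn 2s≢rn
  where
  open Inverse ℓ using (from; to; strictlyInverseˡ)
  from-injective : Injective _≡_ _≡_ from
  from-injective {p} {p′} eq = trans (sym (strictlyInverseˡ p)) (trans (cong to eq) (strictlyInverseˡ p′))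
  degree≤ : ∀ k → k + s ≤ numEdges (suc L) → ∀ v → degree from k s v ≤ r
  degree≤ k k+s≤N v = subst (_≤ r) (length-filterᵇ-tabulate
    (λ p → (k ≤ᵇ toℕ p) ∧ (toℕ p <ᵇ k + s) ∧ incident v (from p)) id) (good k k+s≤N v)
  2s≤rn : s + s ≤ r * suc L
  2s≤rn = subst₂ _≤_ (sum-degree from s s≤N) (*-comm (suc L) r) (sum-≤ (degree from 0 s) (degree≤ 0 s≤N))
  2s≢rn : s + s ≢ r * suc L
  2s≢rn eq = regular-impossible from from-injective 1≤s s<N
    (sum-saturated (degree from 0 s) (degree≤ 0 s≤N)
      (≤-reflexive (trans (*-comm (suc L) r) (trans (sym eq) (sym (sum-degree from s s≤N))))))
    (degree≤ 1 s<N)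
    where
    open ≤-Reasoning
    s≢0 : s ≢ 0
    s≢0 s≡0 = <⇒≢ (*-mono-≤ 1≤r (s≤s (z≤n {L}))) (trans (cong (λ s → s + s) (sym s≡0)) eq)
    1≤s : 1 ≤ s
    1≤s = n≢0⇒n>0 s≢0
    s<N : s < numEdges (suc L)
    s<N = *-cancelˡ-< 2 s (numEdges (suc L)) (begin-strict
      2 * s                  ≡⟨ cong (s +_) (+-identityʳ s) ⟩
      s + s                  ≡⟨ eq ⟩
      r * suc L              <⟨ *-monoˡ-< (suc L) r<L ⟩
      L * suc L              ≡⟨ *-comm L (suc L) ⟩
      suc L * L              ≡⟨ 2*numEdges L ⟨
      2 * numEdges (suc L)   ∎)

theorem4 : (n r : ℕ) → 3 ≤ n → 1 ≤ r → r ≤ n ∸ 2 →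
    (2 ∣ n ⊎ 2 ∣ r ⊎ (¬ (2 ∣ n) × (n ∸ 1 ≤ 2 * r ⊎ gcd r (n ∸ 1) ≡ 1))) →
    MsK n r ((r * n ∸ 1) / 2)
theorem4 (suc L@(suc _)) r (s≤s (s≤s _)) 1≤r r≤L∸1 _ =
  lowerBound L r s 1≤r (<⇒≤ r<L) fits , λ ℓ s′ good → maximal s′ (upperBound L r s′ ℓ 1≤r r<L good)
  where
  -- This is the largest `s` with `s + s < r * n`: `fits` is the inequality itself, `maximal` the
  -- maximality.
  s = (r * suc L ∸ 1) / 2
  r<L : r < L
  r<L = s≤s r≤L∸1
  double : ∀ a → a * 2 ≡ a + a
  double = solve-∀
  fits : s + s + 1 ≤ r * suc L
  fits = begin
    s + s + 1               ≡⟨ cong (_+ 1) (double s) ⟨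
    s * 2 + 1               ≤⟨ +-monoˡ-≤ 1 (m/n*n≤m (r * suc L ∸ 1) 2) ⟩
    r * suc L ∸ 1 + 1       ≡⟨ m∸n+n≡m (*-mono-≤ 1≤r (s≤s (z≤n {L}))) ⟩
    r * suc L               ∎
    where open ≤-Reasoning
  maximal : ∀ s′ → s′ + s′ < r * suc L → s′ ≤ s
  maximal s′ h = begin
    s′                      ≡⟨ m*n/n≡m s′ 2 ⟨
    s′ * 2 / 2              ≡⟨ cong (_/ 2) (double s′) ⟩
    (s′ + s′) / 2           ≤⟨ /-monoˡ-≤ 2 (m+n≤o⇒m≤o∸n (s′ + s′) (≤-trans (≤-reflexive (+-comm (s′ + s′) 1)) h)) ⟩
    s                       ∎
    where open ≤-Reasoning
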